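{- Let $p$ be an odd prime and let $\mu=\max\{v_2(p-1), v_2(p+1)\}$. Let $T_2$ be the Chebyshev polynomial of degree $2$. Then for every integer $\nu\ge 0$, $$\lim_{\substack{n \to \infty\\ v_2(n)=\nu}}\frac{\#\operatorname{Per}\left(T_2, \mathbb{F}_{p^n}\right)}{p^n}=\frac{2^{\mu+\nu-1}+1}{2^{\mu+\nu+1}}.$$
   Context: For a polynomial $\phi$ with integer coefficients (reduced mod $p$) and a field $K$ of characteristic $p$, $\operatorname{Per}(\phi,K)=\{\alpha\in K : \phi^m(\alpha)=\alpha \text{ for some } m>0\}$, where $\phi^m$ is the $m$-th iterate of $\phi$ under composition. $\mathbb{F}_{p^n}$ is the field with $p^n$ elements. $v_2$ is the $2$-adic valuation. The Chebyshev polynomials $T_d\in\mathbb{Z}[w]$ are defined by $T_0(w)=2$, $T_1(w)=w$, $T_d(w)=wT_{d-1}(w)-T_{d-2}(w)$ for $d\ge 2$ (equivalently $T_d(z+z^{ -1})=z^d+z^{ -d}$); in particular $T_2(w)=w^2-2$. The limit is taken as $n\to\infty$ through the positive integers $n$ with $v_2(n)=\nu$. -}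

module Defs where

open import Algebra.Apartness.Bundles using (HeytingField; module HeytingCommutativeRing)
open import Algebra.Bundles using (CommutativeRing)
import Algebra.Definitions.RawMonoid as RawMonoidDefs
open import Data.Fin.Base as Fin using (Fin; toℕ)
open import Data.Fin.Properties as Fin using (any?; pigeonhole; toℕ<n; toℕ-fromℕ<)
open import Data.Integer.Base as ℤ using (ℤ; +_; -[1+_])
open import Data.List.Base using (List; []; _∷_; map; length; filter; allFin)
open import Data.Nat.Base
open import Data.Nat.Divisibility using (_∣_; _∣?_; ∣⇒≤; 1∣_)
open import Data.Nat.GeneralisedArithmetic using (fold; fold-+)
open import Data.Nat.Properties
open import Data.Product.Base using (∃-syntax; _×_; _,_)
open import Data.Rational.Base as ℚ using (ℚ; 0ℚ)
open import Function.Bundles using (Inverse)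
open import Level using (Level) renaming (suc to lsuc; _⊔_ to _⊔ˡ_)
open import Relation.Binary.Definitions using (Decidable)
open import Relation.Binary.PropositionalEquality as ≡ using (_≡_)
open import Relation.Nullary using (¬_; Dec; yes; no; contradiction)
open import Relation.Nullary.Decidable using (map′)

private variable
  c ℓ₁ ℓ₂ : Level

-- The largest e ≤ k with 2 ^ e ∣ n.
v₂-upTo : ℕ → ℕ → ℕ
v₂-upTo n zero    = 0
v₂-upTo n (suc k) with 2 ^ suc k ∣? n
... | yes _ = suc k
... | no  _ = v₂-upTo n k

-- The 2-adic valuation of a positive integer n: since n < 2 ^ n, the bound n
-- loses nothing (see v₂-spec).  The value at 0 is meaningless.
v₂ : ℕ → ℕ
v₂ n = v₂-upTo n n

v₂-upTo-∣ : ∀ n k → 2 ^ v₂-upTo n k ∣ n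
v₂-upTo-∣ n zero    = 1∣ n
v₂-upTo-∣ n (suc k) with 2 ^ suc k ∣? n
... | yes d = d
... | no  _ = v₂-upTo-∣ n k

v₂-upTo-max : ∀ n k {j} → j ≤ k → 2 ^ j ∣ n → j ≤ v₂-upTo n k
v₂-upTo-max n zero    j≤0 _ = j≤0
v₂-upTo-max n (suc k) {j} j≤1+k d with 2 ^ suc k ∣? n
... | yes _  = j≤1+k
... | no  ¬d = v₂-upTo-max n k
  (s≤s⁻¹ (≤∧≢⇒< j≤1+k λ { ≡.refl → ¬d d })) d

n<2^n : ∀ n → n < 2 ^ n
n<2^n zero    = s≤s z≤n
n<2^n (suc n) = ≤-trans (+-mono-≤ (m^n>0 2 n) (n<2^n n))
                        (+-monoʳ-≤ (2 ^ n) (m≤m+n (2 ^ n) 0))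

v₂-spec : ∀ n .{{_ : NonZero n}} → 2 ^ v₂ n ∣ n × ¬ (2 ^ suc (v₂ n) ∣ n)
v₂-spec n = v₂-upTo-∣ n n , λ d → 1+n≰n (v₂-upTo-max n n
  (<⇒≤ (<-≤-trans (n<2^n (suc (v₂ n))) (∣⇒≤ d))) d)

-- Coefficients in increasing degree; trailing zeros are allowed.
ℤ[w] : Set
ℤ[w] = List ℤ

infixl 6 _⊖_
_⊖_ : ℤ[w] → ℤ[w] → ℤ[w]
f       ⊖ []      = f
[]      ⊖ g       = map ℤ.-_ g
(a ∷ f) ⊖ (b ∷ g) = (a ℤ.- b) ∷ (f ⊖ g)

w·_ : ℤ[w] → ℤ[w]
w· f = + 0 ∷ f

T : ℕ → ℤ[w]
T zero          = + 2 ∷ []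
T (suc zero)    = + 0 ∷ + 1 ∷ []
T (suc (suc d)) = w· T (suc d) ⊖ T d

module Evaluation (R : CommutativeRing c ℓ₁) where
  open CommutativeRing R renaming (_+_ to _+ᴿ_; _*_ to _*ᴿ_; -_ to -ᴿ_)
  open RawMonoidDefs +-rawMonoid using () renaming (_×_ to _×ᴿ_)

  -- The ring homomorphism ℤ → R; for R of characteristic p it factors through
  -- reduction mod p.
  fromℤ : ℤ → Carrier
  fromℤ (+ n)    = n ×ᴿ 1#
  fromℤ -[1+ n ] = -ᴿ (suc n ×ᴿ 1#)

  ⟦_⟧ : ℤ[w] → Carrier → Carrier
  ⟦ []    ⟧ x = 0#
  ⟦ a ∷ f ⟧ x = fromℤ a +ᴿ x *ᴿ ⟦ f ⟧ x

  ⟦_⟧-cong : ∀ f {x y} → x ≈ y → ⟦ f ⟧ x ≈ ⟦ f ⟧ y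
  ⟦ []    ⟧-cong x≈y = refl
  ⟦ a ∷ f ⟧-cong x≈y = +-cong refl (*-cong x≈y (⟦ f ⟧-cong x≈y))

module _ (K : HeytingField c ℓ₁ ℓ₂) where
  open HeytingField K using (Carrier; _≈_; heytingCommutativeRing)
  open HeytingCommutativeRing heytingCommutativeRing
    using (commutativeRing)
  open Evaluation commutativeRing

  -- The value at α of the m-th compositional iterate of φ is obtained by
  -- applying the polynomial function of φ to α m times.
  _^[_]_ : ℤ[w] → ℕ → Carrier → Carrier
  φ ^[ m ] α = fold α ⟦ φ ⟧ m

  Per : ℤ[w] → Carrier → Set ℓ₁
  Per φ α = ∃[ m ] 0 < m × φ ^[ m ] α ≈ α

-- A field with exactly q elements, counted up to its equality _≈_.  On a finite
-- carrier _≈_ is decidable, hence so is invertibility, and the apartness x # y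
-- is just ¬ x ≈ y.  The law invertible⇒# makes 1 # 0, so 1 ≉ 0.
record FiniteField c ℓ₁ ℓ₂ (q : ℕ) : Set (lsuc (c ⊔ˡ ℓ₁ ⊔ˡ ℓ₂)) where
  field
    heytingField : HeytingField c ℓ₁ ℓ₂

  open HeytingField heytingField public
  open HeytingCommutativeRing heytingCommutativeRing public
    using (commutativeRing)

  field
    enumeration : Inverse setoid (≡.setoid (Fin q))

  open Inverse enumeration public
    using ()
    renaming (to to index; from to element; to-cong to index-cong; inverseʳ to element-index)

  index-injective : ∀ {x y} → index x ≡ index y → x ≈ y
  index-injective eq = trans (sym (element-index ≡.refl)) (element-index eq)

  _≈?_ : Decidable _≈_
  x ≈? y = map′ index-injective index-cong (index x Fin.≟ index y)

module _ {q} (K : FiniteField c ℓ₁ ℓ₂ q) (φ : ℤ[w]) where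
  open FiniteField K using
    ( Carrier; _≈_; _≈?_; setoid; refl; sym; trans; reflexive
    ; heytingField; commutativeRing; index; index-injective )
  open Evaluation commutativeRing

  it : ℕ → Carrier → Carrier
  it m α = _^[_]_ heytingField φ m α

  it-+ : ∀ m n α → it (m + n) α ≈ it m (it n α)
  it-+ m n α = reflexive (fold-+ α ⟦ φ ⟧ m)

  it-cong : ∀ m {α β} → α ≈ β → it m α ≈ it m β
  it-cong zero    eq = eq
  it-cong (suc m) eq = ⟦ φ ⟧-cong (it-cong m eq)

  it-comm : ∀ m n α → it m (it n α) ≈ it n (it m α)
  it-comm m n α = trans (sym (it-+ m n α))
    (trans (reflexive (≡.cong (λ k → it k α) (+-comm m n))) (it-+ n m α))

  it-multiple : ∀ k m {α} → it m α ≈ α → it (k * m) α ≈ α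
  it-multiple zero    m eq = refl
  it-multiple (suc k) m {α} eq = trans (it-+ m (k * m) α)
    (trans (it-cong m (it-multiple k m eq)) eq)

  -- A periodic point whose orbit satisfies it i α ≈ it (d + i) α has it d α ≈ α.
  cancel : ∀ {α} m i d → 0 < m → it m α ≈ α → it i α ≈ it (d + i) α → it d α ≈ α
  cancel {α} m@(suc _) i d _ per eq = begin
    it d α               ≈⟨ it-cong d back ⟨
    it d (it r (it i α)) ≈⟨ it-comm d r (it i α) ⟩
    it r (it d (it i α)) ≈⟨ it-cong r (it-+ d i α) ⟨
    it r (it (d + i) α)  ≈⟨ it-cong r eq ⟨
    it r (it i α)        ≈⟨ back ⟩
    α                    ∎
    where
    open import Relation.Binary.Reasoning.Setoid setoid
    r : ℕ
    r = i * m ∸ i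
    back : it r (it i α) ≈ α
    back = begin
      it r (it i α) ≈⟨ it-+ r i α ⟨
      it (r + i) α  ≡⟨ ≡.cong (λ k → it k α) (m∸n+n≡m (m≤m*n i m)) ⟩
      it (i * m) α  ≈⟨ it-multiple i m per ⟩
      α             ∎

  short : ∀ α → Per heytingField φ α → ∃[ j ] it (suc (toℕ {q} j)) α ≈ α
  short α (m , 0<m , per)
    with i , j , i<j , eq ← pigeonhole (n<1+n q) (λ k → index (it (toℕ k) α))
    = Fin.fromℕ< e<q , trans (reflexive (≡.cong (λ k → it k α) suc-e))
        (cancel m (toℕ i) d 0<m per (trans (index-injective eq)
          (reflexive (≡.cong (λ k → it k α) (≡.sym (m∸n+n≡m (<⇒≤ i<j)))))))
    where
    d e : ℕ
    d = toℕ j ∸ toℕ i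
    e = pred d
    1+e≡d : suc e ≡ d
    1+e≡d = suc-pred d {{>-nonZero (m<n⇒0<n∸m i<j)}}
    e<q : e < q
    e<q = ≤-trans (≤-reflexive 1+e≡d) (≤-trans (m∸n≤m (toℕ j) (toℕ i)) (s≤s⁻¹ (toℕ<n j)))
    suc-e : suc (toℕ (Fin.fromℕ< e<q)) ≡ d
    suc-e = ≡.trans (≡.cong suc (toℕ-fromℕ< e<q)) 1+e≡d

  Per? : ∀ α → Dec (Per heytingField φ α)
  Per? α = map′ (λ { (j , eq) → suc (toℕ j) , s≤s z≤n , eq }) (short α)
                (any? (λ (j : Fin q) → it (suc (toℕ j)) α ≈? α))

#Per : ∀ {q} → ℤ[w] → FiniteField c ℓ₁ ℓ₂ q → ℕ
#Per {q = q} φ K = length (filter (λ i → Per? K φ (FiniteField.element K i)) (allFin q))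

-- L is the limit of f n as n → ∞ through the positive integers satisfying P.
-- For rational f and L, rational ε > 0 suffice.
LimitAlong : (ℕ → Set) → (∀ n → .{{NonZero n}} → ℚ) → ℚ → Set
LimitAlong P f L =
  ∀ (ε : ℚ) → 0ℚ ℚ.< ε →
  ∃[ N ] (∀ n → .{{_ : NonZero n}} → N ≤ n → P n → ℚ.∣ f n ℚ.- L ∣ ℚ.< ε)

{-# OPTIONS --safe #-}

-- Write w = 2 x.  If 4 - w² is a square, then w comes from a point (x , y) of
-- the circle x² + y² = 1, and T₂ (w) = w² - 2 comes from the double of that point.
-- The circle is an abelian group whose only element of order 2 is (- 1 , 0), so
-- doubling halves a subgroup of even order and permutes one of odd order: its
-- periodic points form a subgroup of order m, where N = 2 ^ s m is the order of
-- the circle and m is odd.  Identifying (x , y) with (x , - y) leaves (m + 1) / 2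
-- periodic values of w.
-- If 4 - w² is not a square, then w is periodic exactly when it lies in the image
-- of T₂: there 2 + w is a square and 2 - w is not, whence T₂ is injective.
-- With q = p ^ n, together 4 #Per + N = 2 q + 2 m.  Finally N = q ± 1 is divisible by 4, which
-- forces s = μ + ν, and #Per / q differs from the limit by less than 1 / q.
module Submission where

open import Defs
open import Algebra.Bundles using (CommutativeRing; RawRing)
open import Algebra.Core using (Op₁; Op₂)
import Algebra.Morphism.RingMonomorphism as RingMonomorphism
open import Algebra.Morphism.Structures using (IsRingMonomorphism)
import Algebra.Properties.AbelianGroup as AbelianGroupProperties
import Algebra.Properties.Ring as RingProperties
import Algebra.Properties.Semiring.Mult.TCOptimised as Mult
import Algebra.Solver.Ring
open import Algebra.Solver.Ring.AlmostCommutativeRing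
  using (fromCommutativeRing; _-Raw-AlmostCommutative⟶_)
open import Algebra.Structures using (IsCommutativeRing)
open import Data.Empty using (⊥; ⊥-elim)
open import Data.Fin.Base using (Fin; toℕ)
import Data.Fin.Properties as Fin
open import Data.Integer.Base as ℤ using (ℤ; +_; -[1+_]; 0ℤ; 1ℤ; -1ℤ)
import Data.Integer.Properties as ℤ
open import Data.Integer.Solver using () renaming (module +-*-Solver to ℤ-Solver)
open import Data.List.Base
  using (List; []; _∷_; map; length; lookup; filter; deduplicate; cartesianProduct; allFin)
import Data.List.Membership.DecPropositional as DecMembership
open import Data.List.Membership.Propositional using (_∈_; _∉_; lose; find)
open import Data.List.Membership.Propositional.Properties
  using (∈-map⁺; ∈-map⁻; ∈-filter⁺; ∈-filter⁻; ∈-deduplicate⁺; ∈-deduplicate⁻; ∈-cartesianProduct⁺;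
         ∈-++⁺ˡ; ∈-++⁺ʳ; ∈-++⁻; ∈-allFin)
open import Data.List.Membership.Propositional.Properties.WithK using (unique∧set⇒bag)
open import Data.List.Properties
  using (length-map; length-++; length-tabulate; filter-accept; filter-reject; filter-none)
open import Data.List.Relation.Binary.BagAndSetEquality using (∼bag⇒↭)
open import Data.List.Relation.Binary.Permutation.Propositional using (_↭_)
open import Data.List.Relation.Binary.Permutation.Propositional.Properties using (↭-length; filter-↭)
open import Data.List.Relation.Unary.All as All using (All; []; _∷_)
import Data.List.Relation.Unary.All.Properties as All
open import Data.List.Relation.Unary.AllPairs using ([]; _∷_)
open import Data.List.Relation.Unary.Any as Any using (here; there; any?)
open import Data.List.Relation.Unary.Any.Properties using (lookup-index)
open import Data.List.Relation.Unary.Unique.Propositional using (Unique)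
import Data.List.Relation.Unary.Unique.DecPropositional.Properties as UniqueDec
import Data.List.Relation.Unary.Unique.Propositional.Properties as Unique
import Data.Maybe.Base as Maybe
open import Data.Nat.Base as ℕ using (ℕ; zero; suc; NonZero; _≤_; _<_; s≤s; z≤n)
open import Data.Nat.Divisibility using (_∣_; divides; *-monoʳ-∣; ∣⇒≤)
open import Data.Nat.GeneralisedArithmetic using (fold; fold-+)
open import Data.Nat.Primality using (Prime; prime⇒nonZero; prime⇒nonTrivial; ¬prime[1])
import Data.Nat.Properties as ℕ
open import Data.Nat.Properties using (m^n≢0)
open import Data.Nat.Solver using (module +-*-Solver)
open import Data.Product.Base using (∃-syntax; _×_; _,_; proj₁; proj₂)
open import Data.Product.Properties using (≡-dec)
open import Data.Rational.Base as ℚ using (ℚ; mkℚ; 0ℚ; _/_; toℚᵘ; ↧ₙ_)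
import Data.Rational.Properties as ℚ
open import Data.Rational.Unnormalised.Base as ℚᵘ using (mkℚᵘ; _≃_)
import Data.Rational.Unnormalised.Properties as ℚᵘ
open import Data.Sum.Base as Sum using (_⊎_; inj₁; inj₂; [_,_]′)
open import Data.Vec.N-ary using (N-ary; Eq; curryⁿ; curryⁿ-cong)
open import Function.Base using (id; _∘_)
open import Function.Bundles using (Inverse; mk⇔)
open import Level using (Level; 0ℓ)
open import Relation.Binary.Definitions using (DecidableEquality)
open import Relation.Binary.PropositionalEquality
  using (_≡_; _≢_; refl; sym; trans; cong; cong₂; subst; subst₂; module ≡-Reasoning)
import Relation.Binary.Reasoning.Setoid as ≈-Reasoning
import Relation.Binary.Reflection as Reflection
open import Relation.Nullary using (¬_; Dec; yes; no; ¬?; contradiction; dec⇒maybe)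

-- Under `w = z + 1/z` the values `w` come from two groups, of orders `q - 1` and `q + 1`: the
-- multiplicative group of the field and the norm one group of its quadratic extension. Exactly one
-- of these orders is divisible by 4. The circle is isomorphic to the group with that order, whether
-- or not - 1 is a square, because it always contains the point `(0 , 1)` of order 4. The order of
-- the other group is twice an odd number, so doubling permutes its doubled elements. On their
-- traces, the remaining values in the image of T₂, injectivity follows from a remark about squares,
-- and no quadratic extension has to be built. The limit is visible from the sizes of the pieces.
-- The image of T₂ has about `q / 2` elements, half of them coming from the circle. The other half
-- is periodic throughout and contributes 1/4; the circle contributes about `m / 2`, that is, about
-- `q / 2 ^ (μ + ν + 1)` values. The exponent `μ + ν` is lifting the exponent at 2: each squaring
-- adds 1 to the larger of the valuations of `q - 1` and `q + 1`, and odd powers preserve it.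

private variable
  ℓ ℓ′ : Level
  A B : Set ℓ

-- Finite sets as lists without repetitions

sameElements⇒↭ : {xs ys : List A} → Unique xs → Unique ys →
  (∀ {x} → x ∈ xs → x ∈ ys) → (∀ {x} → x ∈ ys → x ∈ xs) → xs ↭ ys
sameElements⇒↭ xs! ys! ⊆ ⊇ = ∼bag⇒↭ (unique∧set⇒bag xs! ys! (mk⇔ ⊆ ⊇))

sameElements⇒length≡ : {xs ys : List A} → Unique xs → Unique ys →
  (∀ {x} → x ∈ xs → x ∈ ys) → (∀ {x} → x ∈ ys → x ∈ xs) → length xs ≡ length ys
sameElements⇒length≡ xs! ys! ⊆ ⊇ = ↭-length (sameElements⇒↭ xs! ys! ⊆ ⊇)

length-disjoint : {xs ys zs : List A} → Unique xs → Unique ys → Unique zs →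
  (∀ {x} → x ∈ xs → x ∉ ys) → (∀ {x} → x ∈ zs → x ∈ xs ⊎ x ∈ ys) →
  (∀ {x} → x ∈ xs → x ∈ zs) → (∀ {x} → x ∈ ys → x ∈ zs) → length zs ≡ length xs ℕ.+ length ys
length-disjoint {xs = xs} xs! ys! zs! disjoint split ⊇ˡ ⊇ʳ = trans
  (sameElements⇒length≡ zs! (Unique.++⁺ xs! ys! (λ (∈xs , ∈ys) → disjoint ∈xs ∈ys))
    ([ ∈-++⁺ˡ , ∈-++⁺ʳ xs ]′ ∘ split) ([ ⊇ˡ , ⊇ʳ ]′ ∘ ∈-++⁻ xs))
  (length-++ xs)

unique-map : (g : A → B) {xs : List A} → Unique xs →
  (∀ {x y} → x ∈ xs → y ∈ xs → g x ≡ g y → x ≡ y) → Unique (map g xs)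
unique-map g {[]} _ _ = []
unique-map g {x ∷ xs} (x∉ ∷ xs!) inj =
  All.map⁺ (All.tabulate (λ y∈ eq → All.lookup x∉ y∈ (inj (here refl) (there y∈) eq)))
  ∷ unique-map g xs! (λ ∈₁ ∈₂ → inj (there ∈₁) (there ∈₂))

Periodic : {A : Set ℓ} → (A → A) → A → Set ℓ
Periodic g x = ∃[ m ] 0 < m × fold x g m ≡ x

module _ (f : A → A) (xs : List A) (closed : ∀ {x} → x ∈ xs → f x ∈ xs)
         (injective : ∀ {x y} → x ∈ xs → y ∈ xs → f x ≡ f y → x ≡ y) where

  iterate-closed : ∀ m {x} → x ∈ xs → fold x f m ∈ xs
  iterate-closed zero    x∈ = x∈
  iterate-closed (suc m) x∈ = closed (iterate-closed m x∈)

  iterate-injective : ∀ m {x y} → x ∈ xs → y ∈ xs → fold x f m ≡ fold y f m → x ≡ y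
  iterate-injective zero    x∈ y∈ eq = eq
  iterate-injective (suc m) x∈ y∈ eq = iterate-injective m x∈ y∈
    (injective (iterate-closed m x∈) (iterate-closed m y∈) eq)

  -- Two of the first `length xs + 1` iterates occupy the same position of `xs`, and injectivity
  -- strips the common initial steps.
  injective⇒periodic : ∀ {x} → x ∈ xs → Periodic f x
  injective⇒periodic {x} x∈
    with i , j , i<j , eq ← Fin.pigeonhole (ℕ.n<1+n _) (λ k → Any.index (iterate-closed (toℕ k) x∈))
    = toℕ j ℕ.∸ toℕ i , ℕ.m<n⇒0<n∸m i<j ,
      sym (iterate-injective (toℕ i) x∈ (iterate-closed (toℕ j ℕ.∸ toℕ i) x∈) (begin
        fold x f (toℕ i)                             ≡⟨ lookup-index (iterate-closed (toℕ i) x∈) ⟩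
        lookup xs (Any.index (iterate-closed (toℕ i) x∈)) ≡⟨ cong (lookup xs) eq ⟩
        lookup xs (Any.index (iterate-closed (toℕ j) x∈)) ≡⟨ lookup-index (iterate-closed (toℕ j) x∈) ⟨
        fold x f (toℕ j)                             ≡⟨ cong (fold x f) (ℕ.m+[n∸m]≡n (ℕ.<⇒≤ i<j)) ⟨
        fold x f (toℕ i ℕ.+ (toℕ j ℕ.∸ toℕ i))           ≡⟨ fold-+ x f (toℕ i) ⟩
        fold (fold x f (toℕ j ℕ.∸ toℕ i)) f (toℕ i)    ∎))
    where open ≡-Reasoning

module _ {A : Set ℓ} {B : Set ℓ′} (_≟ᴬ_ : DecidableEquality A) (_≟ᴮ_ : DecidableEquality B) where

  image : (A → B) → List A → List B
  image f xs = deduplicate _≟ᴮ_ (map f xs)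

  image-unique : ∀ f xs → Unique (image f xs)
  image-unique f xs = UniqueDec.deduplicate-! _≟ᴮ_ (map f xs)

  ∈-image⁺ : ∀ f {xs x} → x ∈ xs → f x ∈ image f xs
  ∈-image⁺ f x∈ = ∈-deduplicate⁺ _≟ᴮ_ (∈-map⁺ f x∈)

  ∈-image⁻ : ∀ f {xs y} → y ∈ image f xs → ∃[ x ] x ∈ xs × y ≡ f x
  ∈-image⁻ f {xs} y∈ = ∈-map⁻ f (∈-deduplicate⁻ _≟ᴮ_ (map f xs) y∈)

  module _ (f : A → B) (σ : A → A) where

    fixed? : ∀ x → Dec (σ x ≡ x)
    fixed? x = σ x ≟ᴬ x

    -- Orbit counting for a group of order 2. Every fibre is `x` together with `σ x`: two points if
    -- they differ, otherwise one point that is counted again as a fixed point. Either way it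
    -- contributes 2. The induction removes one fibre at a time.
    involution-orbits : ∀ {xs} (ys : List B) → Unique xs → Unique ys →
      (∀ {x} → x ∈ xs → f x ∈ ys) →
      (∀ {y} → y ∈ ys → ∃[ x ] x ∈ xs × y ≡ f x) →
      (∀ {x} → x ∈ xs → σ x ∈ xs × f (σ x) ≡ f x) →
      (∀ {x x′} → x ∈ xs → x′ ∈ xs → f x ≡ f x′ → x′ ≡ x ⊎ x′ ≡ σ x) →
      length xs ℕ.+ length (filter fixed? xs) ≡ 2 ℕ.* length ys
    involution-orbits {[]}    []  _ _ _ _ _ _ = refl
    involution-orbits {x ∷ _} [] _ _ into _ _ _ with () ← into (here refl)
    involution-orbits {xs} (y ∷ ys) xs! (y∉ ∷ ys!) into onto inv fibre
      with x , x∈ , refl ← onto (here refl) = go (fixed? x)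
      where
      f≢y? : ∀ x′ → Dec (f x′ ≢ f x)
      f≢y? x′ = ¬? (f x′ ≟ᴮ f x)
      xs′ = filter f≢y? xs
      xs′! : Unique xs′
      xs′! = Unique.filter⁺ f≢y? xs!
      into′ : ∀ {x′} → x′ ∈ xs′ → f x′ ∈ ys
      into′ x′∈ with into (proj₁ (∈-filter⁻ f≢y? {xs = xs} x′∈))
      ... | here eq = contradiction eq (proj₂ (∈-filter⁻ f≢y? {xs = xs} x′∈))
      ... | there ∈ys = ∈ys
      onto′ : ∀ {y} → y ∈ ys → ∃[ x′ ] x′ ∈ xs′ × y ≡ f x′
      onto′ y∈ with x′ , x′∈ , refl ← onto (there y∈) =
        x′ , ∈-filter⁺ f≢y? x′∈ (λ eq → All.lookup y∉ y∈ (sym eq)) , refl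
      inv′ : ∀ {x} → x ∈ xs′ → σ x ∈ xs′ × f (σ x) ≡ f x
      inv′ x′∈ with ∈xs , ≢y ← ∈-filter⁻ f≢y? {xs = xs} x′∈ with σ∈ , eq ← inv ∈xs =
        ∈-filter⁺ f≢y? σ∈ (≢y ∘ trans (sym eq)) , eq
      ⊆xs : ∀ {x′} → x′ ∈ xs′ → x′ ∈ xs
      ⊆xs = proj₁ ∘ ∈-filter⁻ f≢y? {xs = xs}
      rest : length xs′ ℕ.+ length (filter fixed? xs′) ≡ 2 ℕ.* length ys
      rest = involution-orbits ys xs′! ys! into′ onto′ inv′
        (λ ∈₁ ∈₂ → fibre (⊆xs ∈₁) (⊆xs ∈₂))
      fibre∉ : ∀ {x₀} → f x₀ ≡ f x → All (x₀ ≢_) xs′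
      fibre∉ eq = All.tabulate λ { x′∈ refl → proj₂ (∈-filter⁻ f≢y? {xs = xs} x′∈) eq }
      go : Dec (σ x ≡ x) → length xs ℕ.+ length (filter fixed? xs) ≡ 2 ℕ.* suc (length ys)
      go (yes σx≡x) = begin
        length xs ℕ.+ length (filter fixed? xs)
          ≡⟨ cong₂ ℕ._+_ (↭-length perm) (↭-length (filter-↭ fixed? perm)) ⟩
        suc (length xs′) ℕ.+ length (filter fixed? (x ∷ xs′))
          ≡⟨ cong (λ zs → suc (length xs′) ℕ.+ length zs) (filter-accept fixed? σx≡x) ⟩
        suc (length xs′) ℕ.+ suc (length (filter fixed? xs′))
          ≡⟨ cong suc (ℕ.+-suc _ _) ⟩
        2 ℕ.+ (length xs′ ℕ.+ length (filter fixed? xs′))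
          ≡⟨ cong (2 ℕ.+_) rest ⟩
        2 ℕ.+ 2 ℕ.* length ys
          ≡⟨ ℕ.*-suc 2 (length ys) ⟨
        2 ℕ.* suc (length ys) ∎
        where
        open ≡-Reasoning
        ⊆ : ∀ {x′} → x′ ∈ xs → x′ ∈ x ∷ xs′
        ⊆ {x′} x′∈ with f x′ ≟ᴮ f x
        ... | no ≢y = there (∈-filter⁺ f≢y? x′∈ ≢y)
        ... | yes eq with fibre x∈ x′∈ (sym eq)
        ...   | inj₁ refl = here refl
        ...   | inj₂ refl = here σx≡x
        perm : xs ↭ x ∷ xs′
        perm = sameElements⇒↭ xs! (fibre∉ refl ∷ xs′!) ⊆
          λ { (here refl) → x∈ ; (there x′∈) → ⊆xs x′∈ }
      go (no σx≢x) = begin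
        length xs ℕ.+ length (filter fixed? xs)
          ≡⟨ cong₂ ℕ._+_ (↭-length perm) (↭-length (filter-↭ fixed? perm)) ⟩
        2 ℕ.+ length xs′ ℕ.+ length (filter fixed? (x ∷ σ x ∷ xs′))
          ≡⟨ cong (λ zs → 2 ℕ.+ length xs′ ℕ.+ length zs)
               (trans (filter-reject fixed? σx≢x) (filter-reject fixed? σσx≢σx)) ⟩
        2 ℕ.+ (length xs′ ℕ.+ length (filter fixed? xs′))
          ≡⟨ cong (2 ℕ.+_) rest ⟩
        2 ℕ.+ 2 ℕ.* length ys
          ≡⟨ ℕ.*-suc 2 (length ys) ⟨
        2 ℕ.* suc (length ys) ∎
        where
        open ≡-Reasoning
        σx∈ = proj₁ (inv x∈)
        fσx = proj₂ (inv x∈)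
        -- `x` lies in the fibre of `σ x`, so it is `σ x` or `σ (σ x)`; if `σ x` were fixed, both
        -- cases would make `x` fixed.
        σσx≢σx : σ (σ x) ≢ σ x
        σσx≢σx eq with fibre σx∈ x∈ fσx
        ... | inj₁ x≡σx  = σx≢x (sym x≡σx)
        ... | inj₂ x≡σσx = σx≢x (sym (trans x≡σσx eq))
        ⊆ : ∀ {x′} → x′ ∈ xs → x′ ∈ x ∷ σ x ∷ xs′
        ⊆ {x′} x′∈ with f x′ ≟ᴮ f x
        ... | no ≢y = there (there (∈-filter⁺ f≢y? x′∈ ≢y))
        ... | yes eq with fibre x∈ x′∈ (sym eq)
        ...   | inj₁ refl = here refl
        ...   | inj₂ refl = there (here refl)
        perm : xs ↭ x ∷ σ x ∷ xs′
        perm = sameElements⇒↭ xs!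
          (((λ eq → σx≢x (sym eq)) ∷ fibre∉ refl) ∷ (fibre∉ fσx ∷ xs′!)) ⊆
          λ { (here refl) → x∈ ; (there (here refl)) → σx∈ ; (there (there x′∈)) → ⊆xs x′∈ }

    image-orbits : ∀ {xs} → Unique xs →
      (∀ {x} → x ∈ xs → σ x ∈ xs × f (σ x) ≡ f x) →
      (∀ {x x′} → x ∈ xs → x′ ∈ xs → f x ≡ f x′ → x′ ≡ x ⊎ x′ ≡ σ x) →
      length xs ℕ.+ length (filter fixed? xs) ≡ 2 ℕ.* length (image f xs)
    image-orbits {xs} xs! = involution-orbits (image f xs) xs! (image-unique f xs)
      (∈-image⁺ f) (∈-image⁻ f)

-- Integers close to ± 1 modulo a power of 2

Oddℤ : ℤ → Set
Oddℤ i = ∃[ k ] i ≡ 1ℤ ℤ.+ + 2 ℤ.* k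

2*i≢1 : ∀ i → + 2 ℤ.* i ≢ 1ℤ
2*i≢1 i eq = absurd ℤ.∣ i ∣ (trans (sym (ℤ.abs-* (+ 2) i)) (cong ℤ.∣_∣ eq))
  where
  absurd : ∀ n → 2 ℕ.* n ≢ 1
  absurd zero    ()
  absurd (suc n) eq with () ← trans (sym (ℕ.+-suc n (n ℕ.+ 0))) (ℕ.suc-injective eq)

odd≢even : ∀ {i} j → Oddℤ i → i ≢ + 2 ℤ.* j
odd≢even j (k , refl) eq = 2*i≢1 (j ℤ.- k) (begin
  + 2 ℤ.* (j ℤ.- k)                       ≡⟨ solve 2 (λ j k → con (+ 2) :* (j :- k) := con (+ 2) :* j :- con (+ 2) :* k) refl j k ⟩
  + 2 ℤ.* j ℤ.- + 2 ℤ.* k                 ≡⟨ cong (ℤ._- + 2 ℤ.* k) eq ⟨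
  1ℤ ℤ.+ + 2 ℤ.* k ℤ.- + 2 ℤ.* k          ≡⟨ solve 1 (λ k → con 1ℤ :+ con (+ 2) :* k :- con (+ 2) :* k := con 1ℤ) refl k ⟩
  1ℤ                                      ∎)
  where
  open ≡-Reasoning
  open ℤ-Solver

odd-+-even : ∀ {i} j → Oddℤ i → Oddℤ (i ℤ.+ + 2 ℤ.* j)
odd-+-even j (k , refl) = k ℤ.+ j ,
  solve 2 (λ k j → con 1ℤ :+ con (+ 2) :* k :+ con (+ 2) :* j := con 1ℤ :+ con (+ 2) :* (k :+ j)) refl k j
  where open ℤ-Solver

odd-parts-unique : ∀ s t {i j} → Oddℤ i → Oddℤ j → (+ 2) ℤ.^ s ℤ.* i ≡ (+ 2) ℤ.^ t ℤ.* j → s ≡ t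
odd-parts-unique zero    zero    _  _  _  = refl
odd-parts-unique zero    (suc t) {i} {j} oi _ eq = ⊥-elim (odd≢even ((+ 2) ℤ.^ t ℤ.* j) oi
  (trans (sym (ℤ.*-identityˡ i)) (trans eq (ℤ.*-assoc (+ 2) ((+ 2) ℤ.^ t) j))))
odd-parts-unique (suc s) zero    {i} {j} _ oj eq = ⊥-elim (odd≢even ((+ 2) ℤ.^ s ℤ.* i) oj
  (trans (sym (ℤ.*-identityˡ j)) (trans (sym eq) (ℤ.*-assoc (+ 2) ((+ 2) ℤ.^ s) i))))
odd-parts-unique (suc s) (suc t) {i} {j} oi oj eq = cong suc (odd-parts-unique s t oi oj
  (ℤ.*-cancelˡ-≡ (+ 2) _ _ (trans (sym (ℤ.*-assoc (+ 2) ((+ 2) ℤ.^ s) i)) (trans eq (ℤ.*-assoc (+ 2) ((+ 2) ℤ.^ t) j)))))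

Sign : ℤ → Set
Sign ε = ε ≡ 1ℤ ⊎ ε ≡ -1ℤ

sign² : ∀ {ε} → Sign ε → ε ℤ.* ε ≡ 1ℤ
sign² (inj₁ refl) = refl
sign² (inj₂ refl) = refl

odd-sign : ∀ {ε} → Sign ε → Oddℤ ε
odd-sign (inj₁ refl) = ℤ.0ℤ , refl
odd-sign (inj₂ refl) = -1ℤ , refl

odd-* : ∀ {i j} → Oddℤ i → Oddℤ j → Oddℤ (i ℤ.* j)
odd-* (k , refl) (l , refl) = k ℤ.+ l ℤ.+ + 2 ℤ.* k ℤ.* l ,
  solve 2 (λ k l → (con 1ℤ :+ con (+ 2) :* k) :* (con 1ℤ :+ con (+ 2) :* l)
    := con 1ℤ :+ con (+ 2) :* (k :+ l :+ con (+ 2) :* k :* l)) refl k l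
  where open ℤ-Solver

-- For M ≥ 2 this says that { v₂(a - 1) , v₂(a + 1) } = { 1 , M }.
record NearSign (M : ℕ) (a : ℤ) : Set where
  constructor near
  field
    {ε v}  : ℤ
    sign   : Sign ε
    odd    : Oddℤ v
    expand : a ≡ ε ℤ.+ (+ 2) ℤ.^ M ℤ.* v

-- With `M = 2 + j`, the cross term of the square is `2 ^ (M + 1) ε v`, while the last term divided
-- by `2 ^ (M + 1)` is `2 ^ (M - 1) v²`, which is even because `M ≥ 2`. So the cofactor stays odd.
-- Writing the exponent as `2 + j` lets both factors 2 unfold for the solver.
square-expand : ∀ j {a} → NearSign (2 ℕ.+ j) a →
  ∃[ v ] a ℤ.* a ≡ 1ℤ ℤ.+ (+ 2) ℤ.^ (3 ℕ.+ j) ℤ.* v × Oddℤ v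
square-expand j (near {ε} {v} sgn odd refl) = ε ℤ.* v ℤ.+ + 2 ℤ.* (c ℤ.* v ℤ.* v) , (begin
    (ε ℤ.+ + 2 ℤ.* (+ 2 ℤ.* c) ℤ.* v) ℤ.* (ε ℤ.+ + 2 ℤ.* (+ 2 ℤ.* c) ℤ.* v)
      ≡⟨ solve 3 (λ ε c v → (ε :+ two :* (two :* c) :* v) :* (ε :+ two :* (two :* c) :* v)
           := ε :* ε :+ two :* (two :* (two :* c)) :* (ε :* v :+ two :* (c :* v :* v))) refl ε c v ⟩
    ε ℤ.* ε ℤ.+ (+ 2) ℤ.^ (3 ℕ.+ j) ℤ.* (ε ℤ.* v ℤ.+ + 2 ℤ.* (c ℤ.* v ℤ.* v))
      ≡⟨ cong (ℤ._+ (+ 2) ℤ.^ (3 ℕ.+ j) ℤ.* (ε ℤ.* v ℤ.+ + 2 ℤ.* (c ℤ.* v ℤ.* v))) (sign² sgn) ⟩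
    1ℤ ℤ.+ (+ 2) ℤ.^ (3 ℕ.+ j) ℤ.* (ε ℤ.* v ℤ.+ + 2 ℤ.* (c ℤ.* v ℤ.* v)) ∎) ,
  odd-+-even (c ℤ.* v ℤ.* v) (odd-* (odd-sign sgn) odd)
  where
  open ℤ-Solver
  open ≡-Reasoning
  open ℤ-Solver
  c = (+ 2) ℤ.^ j
  two = con (+ 2)

nearSign-square : ∀ j {a} → NearSign (2 ℕ.+ j) a → NearSign (3 ℕ.+ j) (a ℤ.* a)
nearSign-square j near-a with _ , eq , odd ← square-expand j near-a = near (inj₁ refl) odd eq

-- Multiplying by `a²`, which is 1 modulo `2 ^ (M + 1)`, changes the cofactor of `2 ^ M` only by an
-- even number.
nearSign-oddPower : ∀ j {a} → NearSign (2 ℕ.+ j) a → ∀ k → NearSign (2 ℕ.+ j) (a ℤ.^ (1 ℕ.+ 2 ℕ.* k))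
nearSign-oddPower j {a} near-a zero = subst (NearSign (2 ℕ.+ j)) (sym (ℤ.*-identityʳ a)) near-a
nearSign-oddPower j {a} near-a (suc k)
  with near {ε} {v} sgn odd eq ← nearSign-oddPower j near-a k
  with v′ , eq′ , _ ← square-expand j near-a
  = near sgn (odd-+-even (v′ ℤ.* ε ℤ.+ + 2 ℤ.* (+ 2 ℤ.* c) ℤ.* v ℤ.* v′) odd) (begin
    a ℤ.^ (1 ℕ.+ 2 ℕ.* suc k)            ≡⟨ cong (λ e → a ℤ.^ suc e) (ℕ.*-suc 2 k) ⟩
    a ℤ.* (a ℤ.* b)                      ≡⟨ ℤ.*-assoc a a b ⟨
    a ℤ.* a ℤ.* b                        ≡⟨ cong₂ ℤ._*_ eq′ eq ⟩
    (1ℤ ℤ.+ + 2 ℤ.* (+ 2 ℤ.* (+ 2 ℤ.* c)) ℤ.* v′) ℤ.* (ε ℤ.+ + 2 ℤ.* (+ 2 ℤ.* c) ℤ.* v)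
      ≡⟨ solve 4 (λ ε c v v′ → (con 1ℤ :+ two :* (two :* (two :* c)) :* v′) :* (ε :+ two :* (two :* c) :* v)
           := ε :+ two :* (two :* c) :* (v :+ two :* (v′ :* ε :+ two :* (two :* c) :* v :* v′))) refl ε c v v′ ⟩
    ε ℤ.+ + 2 ℤ.* (+ 2 ℤ.* c) ℤ.* (v ℤ.+ + 2 ℤ.* (v′ ℤ.* ε ℤ.+ + 2 ℤ.* (+ 2 ℤ.* c) ℤ.* v ℤ.* v′)) ∎)
  where
  open ≡-Reasoning
  open ℤ-Solver
  c = (+ 2) ℤ.^ j
  b = a ℤ.^ (1 ℕ.+ 2 ℕ.* k)
  two = con (+ 2)

nearSign-2^ : ∀ ν j {a} → NearSign (2 ℕ.+ j) a → NearSign (2 ℕ.+ (j ℕ.+ ν)) (a ℤ.^ (2 ℕ.^ ν))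
nearSign-2^ zero j {a} near-a = subst₂ (λ e → NearSign (2 ℕ.+ e)) (sym (ℕ.+-identityʳ j)) (sym (ℤ.*-identityʳ a)) near-a
nearSign-2^ (suc ν) j {a} near-a = subst₂ (λ e → NearSign (2 ℕ.+ e)) (sym (ℕ.+-suc j ν))
  (trans (sym (ℤ.^-distribˡ-+-* a (2 ℕ.^ ν) (2 ℕ.^ ν)))
    (cong (λ e → a ℤ.^ (2 ℕ.^ ν ℕ.+ e)) (sym (ℕ.+-identityʳ (2 ℕ.^ ν)))))
  (nearSign-square (j ℕ.+ ν) (nearSign-2^ ν j near-a))

-- Valuations of the neighbours of an odd number

Oddℕ : ℕ → Set
Oddℕ n = ∃[ k ] n ≡ 1 ℕ.+ 2 ℕ.* k

odd? : ∀ n → 2 ∣ n ⊎ Oddℕ n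
odd? zero    = inj₁ (divides 0 refl)
odd? (suc n) with odd? n
... | inj₁ (divides k refl) = inj₂ (k , cong suc (ℕ.*-comm k 2))
... | inj₂ (k , refl)       = inj₁ (divides (suc k) (cong (2 ℕ.+_) (ℕ.*-comm 2 k)))

¬2∣⇒odd : ∀ {n} → ¬ 2 ∣ n → Oddℕ n
¬2∣⇒odd {n} ¬2∣n with odd? n
... | inj₁ 2∣n = contradiction 2∣n ¬2∣n
... | inj₂ odd = odd

odd⇒oddℤ : ∀ {n} → Oddℕ n → Oddℤ (+ n)
odd⇒oddℤ (k , refl) = + k , trans (ℤ.pos-+ 1 (2 ℕ.* k)) (cong (ℤ._+_ 1ℤ) (ℤ.pos-* 2 k))

pos-^ : ∀ m n → + (m ℕ.^ n) ≡ (+ m) ℤ.^ n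
pos-^ m zero    = refl
pos-^ m (suc n) = trans (ℤ.pos-* m (m ℕ.^ n)) (cong (+ m ℤ.*_) (pos-^ m n))

pos-2^* : ∀ e m → + (2 ℕ.^ e ℕ.* m) ≡ (+ 2) ℤ.^ e ℤ.* + m
pos-2^* e m = trans (ℤ.pos-* (2 ℕ.^ e) m) (cong (λ i → i ℤ.* + m) (pos-^ 2 e))

v₂-factor : ∀ n .{{_ : NonZero n}} → ∃[ m ] n ≡ 2 ℕ.^ v₂ n ℕ.* m × Oddℕ m
v₂-factor n with divides m eq , ¬d ← v₂-spec n =
  m , trans eq (ℕ.*-comm m _) , ¬2∣⇒odd λ { (divides k refl) → ¬d (divides k
    (trans eq (trans (ℕ.*-assoc k 2 _) refl))) }

2^e∣⇒e≤v₂ : ∀ n e .{{_ : NonZero n}} → 2 ℕ.^ e ∣ n → e ≤ v₂ n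
2^e∣⇒e≤v₂ n e d = v₂-upTo-max n n (ℕ.<⇒≤ (ℕ.<-≤-trans (n<2^n e) (∣⇒≤ d))) d

-- Of two consecutive even numbers one is divisible by 4, which gives the bound 2. The neighbour
-- with the larger valuation supplies the expansion, with sign 1 for the lower one and - 1 for the
-- upper one.
nearSign-base : ∀ t → NearSign (v₂ (2 ℕ.* suc t) ℕ.⊔ v₂ (2 ℕ.+ 2 ℕ.* suc t)) (+ (1 ℕ.+ 2 ℕ.* suc t))
  × 2 ≤ v₂ (2 ℕ.* suc t) ℕ.⊔ v₂ (2 ℕ.+ 2 ℕ.* suc t)
nearSign-base t = near-base (ℕ.≤-total v₊ v₋) , 2≤μ (odd? (suc t))
  where
  open ≡-Reasoning
  a₋ = 2 ℕ.* suc t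
  a₊ = 2 ℕ.+ 2 ℕ.* suc t
  v₋ = v₂ a₋
  v₊ = v₂ a₊
  2≤μ : 2 ∣ suc t ⊎ Oddℕ (suc t) → 2 ≤ v₋ ℕ.⊔ v₊
  2≤μ (inj₁ 2∣) = ℕ.m≤n⇒m≤n⊔o v₊ (2^e∣⇒e≤v₂ a₋ 2 (*-monoʳ-∣ 2 2∣))
  2≤μ (inj₂ (k , refl)) = ℕ.m≤n⇒m≤o⊔n v₋ (2^e∣⇒e≤v₂ a₊ 2
    (subst (4 ∣_) (ℕ.*-suc 2 (suc t)) (*-monoʳ-∣ 2 (divides (suc k) (cong (2 ℕ.+_) (ℕ.*-comm 2 k))))))
  near-base : v₊ ≤ v₋ ⊎ v₋ ≤ v₊ → NearSign (v₋ ℕ.⊔ v₊) (+ (1 ℕ.+ 2 ℕ.* suc t))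
  near-base (inj₁ v₊≤v₋) rewrite ℕ.m≥n⇒m⊔n≡m v₊≤v₋ with m , eq , odd ← v₂-factor a₋ =
    near (inj₁ refl) (odd⇒oddℤ odd) (trans (cong (λ n → + (1 ℕ.+ n)) eq)
      (trans (ℤ.pos-+ 1 _) (cong (ℤ._+_ 1ℤ) (pos-2^* v₋ m))))
  near-base (inj₂ v₋≤v₊) rewrite ℕ.m≤n⇒m⊔n≡n v₋≤v₊ with m , eq , odd ← v₂-factor a₊ =
    near (inj₂ refl) (odd⇒oddℤ odd) (trans (cong (λ n → -1ℤ ℤ.+ + n) eq) (cong (ℤ._+_ -1ℤ) (pos-2^* v₊ m)))

-- If the step from `q` to `N` cancels `ε`, then `N` is `2 ^ (2 + j)` times an odd number and the
-- exponents of 2 agree. Otherwise `N` is `2 ε` plus a multiple of 4, which `4 ∣ N` excludes.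
odd-part-exponent : ∀ j s {q N m} → NearSign (2 ℕ.+ j) (+ q) → N ≡ 1 ℕ.+ q ⊎ 1 ℕ.+ N ≡ q →
  4 ∣ N → N ≡ 2 ℕ.^ s ℕ.* m → Oddℕ m → s ≡ 2 ℕ.+ j
odd-part-exponent j s {q} {N} {m} (near {ε} {v} sgn odd eq) N±1 (divides d N≡d*4) N≡ odd-m = by-sign sgn N±1
  where
  open ≡-Reasoning
  open ℤ-Solver
  c = (+ 2) ℤ.^ j
  X = (+ 2) ℤ.^ (2 ℕ.+ j) ℤ.* v
  opposite : + N ≡ (+ 2) ℤ.^ (2 ℕ.+ j) ℤ.* v → s ≡ 2 ℕ.+ j
  opposite N≡′ = odd-parts-unique s (2 ℕ.+ j) (odd⇒oddℤ odd-m) odd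
    (trans (sym (pos-2^* s m)) (trans (cong +_ (sym N≡)) N≡′))
  same : + N ≡ + 2 ℤ.* ε ℤ.+ (+ 2) ℤ.^ (2 ℕ.+ j) ℤ.* v → ⊥
  same N≡′ = odd≢even (+ d ℤ.- c ℤ.* v) (odd-sign sgn) (ℤ.*-cancelˡ-≡ (+ 2) _ _ (begin
    + 2 ℤ.* ε ≡⟨ solve 3 (λ ε c v → two :* ε := (two :* ε :+ two :* (two :* c) :* v) :- two :* (two :* c) :* v) refl ε c v ⟩
    + 2 ℤ.* ε ℤ.+ (+ 2) ℤ.^ (2 ℕ.+ j) ℤ.* v ℤ.- (+ 2) ℤ.^ (2 ℕ.+ j) ℤ.* v
      ≡⟨ cong (ℤ._- (+ 2) ℤ.^ (2 ℕ.+ j) ℤ.* v) (trans (sym N≡′) (trans (cong +_ N≡d*4) (ℤ.pos-* d 4))) ⟩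
    + d ℤ.* + 4 ℤ.- (+ 2) ℤ.^ (2 ℕ.+ j) ℤ.* v
      ≡⟨ solve 3 (λ d c v → d :* con (+ 4) :- two :* (two :* c) :* v := two :* (two :* (d :- c :* v))) refl (+ d) c v ⟩
    + 2 ℤ.* (+ 2 ℤ.* (+ d ℤ.- c ℤ.* v)) ∎))
    where two = con (+ 2)
  pred≡ : 1 ℕ.+ N ≡ q → + N ≡ -1ℤ ℤ.+ + q
  pred≡ refl = refl
  shift : ∀ δ ε x → δ ℤ.+ (ε ℤ.+ x) ≡ (δ ℤ.+ ε) ℤ.+ x
  shift δ ε x = sym (ℤ.+-assoc δ ε x)
  by-sign : Sign ε → N ≡ 1 ℕ.+ q ⊎ 1 ℕ.+ N ≡ q → s ≡ 2 ℕ.+ j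
  by-sign (inj₁ refl) (inj₁ refl) = ⊥-elim (same (trans (cong (ℤ._+_ 1ℤ) eq) (shift 1ℤ 1ℤ X)))
  by-sign (inj₂ refl) (inj₁ refl) = opposite (trans (cong (ℤ._+_ 1ℤ) eq) (trans (shift 1ℤ -1ℤ X) (ℤ.+-identityˡ X)))
  by-sign (inj₁ refl) (inj₂ N≡q-1) = opposite (trans (pred≡ N≡q-1) (trans (cong (ℤ._+_ -1ℤ) eq) (trans (shift -1ℤ 1ℤ X) (ℤ.+-identityˡ X))))
  by-sign (inj₂ refl) (inj₂ N≡q-1) = ⊥-elim (same (trans (pred≡ N≡q-1) (trans (cong (ℤ._+_ -1ℤ) eq) (shift -1ℤ -1ℤ X))))

-- Split `n` into a power of 2, which costs `v₂ n` squarings, and an odd exponent, which preserves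
-- the level.
nearSign-power : ∀ {p} n .{{_ : NonZero n}} j → NearSign (2 ℕ.+ j) (+ p) →
  NearSign (2 ℕ.+ (j ℕ.+ v₂ n)) (+ (p ℕ.^ n))
nearSign-power {p} n j near-p with k , n≡ , (l , refl) ← v₂-factor n =
  subst (NearSign _) (begin
    ((+ p) ℤ.^ (2 ℕ.^ v₂ n)) ℤ.^ (1 ℕ.+ 2 ℕ.* l)  ≡⟨ ℤ.^-*-assoc (+ p) (2 ℕ.^ v₂ n) (1 ℕ.+ 2 ℕ.* l) ⟩
    (+ p) ℤ.^ (2 ℕ.^ v₂ n ℕ.* (1 ℕ.+ 2 ℕ.* l))    ≡⟨ cong (ℤ._^_ (+ p)) n≡ ⟨
    (+ p) ℤ.^ n                                   ≡⟨ pos-^ p n ⟨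
    + (p ℕ.^ n)                                   ∎)
    (nearSign-oddPower (j ℕ.+ v₂ n) (nearSign-2^ (v₂ n) j near-p) l)
  where open ≡-Reasoning

-- Coefficients in ℤ rather than in R let the solver see that 1 - 1 = 0.
module IntegerSolver (R : CommutativeRing ℓ ℓ′) where
  open CommutativeRing R hiding (zero; refl; sym; trans; reflexive)
  private module ≈ = CommutativeRing R using (refl; sym; trans; reflexive)
  open Mult semiring renaming (_×_ to _×ᴿ_)
  open AbelianGroupProperties +-abelianGroup using (⁻¹-∙-comm)
  open RingProperties ring using (-‿distribˡ-*; -‿distribʳ-*; -‿involutive; -0#≈0#)
  open ≈-Reasoning setoid

  -- This multiple `×ᴿ` satisfies `1 ×ᴿ x = x` by computation, so `con 1ℤ` evaluates to `1#` itself
  -- and solved equations match the goals literally.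
  ι : ℤ → Carrier
  ι (+ n)    = n ×ᴿ 1#
  ι -[1+ n ] = - (suc n ×ᴿ 1#)

  ι-neg : ∀ i → ι (ℤ.- i) ≈ - ι i
  ι-neg (+ zero)  = ≈.sym -0#≈0#
  ι-neg (+ suc n) = ≈.refl
  ι-neg -[1+ n ]  = ≈.sym (-‿involutive _)

  ι-⊖ : ∀ m n → ι (m ℤ.⊖ n) ≈ m ×ᴿ 1# - n ×ᴿ 1#
  ι-⊖ m zero = begin
    ι (m ℤ.⊖ 0)    ≡⟨ cong ι (ℤ.⊖-≥ {m} ℕ.z≤n) ⟩
    m ×ᴿ 1#         ≈⟨ +-identityʳ _ ⟨
    m ×ᴿ 1# + 0#    ≈⟨ +-congˡ -0#≈0# ⟨
    m ×ᴿ 1# - 0#    ∎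
  ι-⊖ zero (suc n) = ≈.sym (+-identityˡ _)
  ι-⊖ (suc m) (suc n) = begin
    ι (suc m ℤ.⊖ suc n)                   ≡⟨ cong ι (ℤ.[1+m]⊖[1+n]≡m⊖n m n) ⟩
    ι (m ℤ.⊖ n)                           ≈⟨ ι-⊖ m n ⟩
    m ×ᴿ 1# - n ×ᴿ 1#                       ≈⟨ +-identityʳ _ ⟨
    m ×ᴿ 1# - n ×ᴿ 1# + 0#                  ≈⟨ +-congˡ (-‿inverseʳ 1#) ⟨
    (m ×ᴿ 1# + - (n ×ᴿ 1#)) + (1# + - 1#)   ≈⟨ +-assoc _ _ _ ⟩
    m ×ᴿ 1# + (- (n ×ᴿ 1#) + (1# + - 1#))   ≈⟨ +-congˡ (+-assoc _ _ _) ⟨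
    m ×ᴿ 1# + ((- (n ×ᴿ 1#) + 1#) + - 1#)   ≈⟨ +-congˡ (+-congʳ (+-comm _ _)) ⟩
    m ×ᴿ 1# + ((1# + - (n ×ᴿ 1#)) + - 1#)   ≈⟨ +-congˡ (+-assoc _ _ _) ⟩
    m ×ᴿ 1# + (1# + (- (n ×ᴿ 1#) + - 1#))   ≈⟨ +-assoc _ _ _ ⟨
    (m ×ᴿ 1# + 1#) + (- (n ×ᴿ 1#) + - 1#)   ≈⟨ +-cong (+-comm _ _) (≈.trans (⁻¹-∙-comm _ _) (-‿cong (+-comm _ _))) ⟩
    (1# + m ×ᴿ 1#) - (1# + n ×ᴿ 1#)         ≈⟨ +-cong (1+× m 1#) (-‿cong (1+× n 1#)) ⟨
    suc m ×ᴿ 1# - suc n ×ᴿ 1#               ∎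

  ι-+ : ∀ i j → ι (i ℤ.+ j) ≈ ι i + ι j
  ι-+ (+ m)    (+ n)    = ×-homo-+ 1# m n
  ι-+ (+ m)    -[1+ n ] = ι-⊖ m (suc n)
  ι-+ -[1+ m ] (+ n)    = ≈.trans (ι-⊖ n (suc m)) (+-comm _ _)
  ι-+ -[1+ m ] -[1+ n ] = begin
    - (suc (suc (m ℕ.+ n)) ×ᴿ 1#)      ≡⟨ cong (λ k → - (suc k ×ᴿ 1#)) (ℕ.+-suc m n) ⟨
    - ((suc m ℕ.+ suc n) ×ᴿ 1#)        ≈⟨ -‿cong (×-homo-+ 1# (suc m) (suc n)) ⟩
    - (suc m ×ᴿ 1# + suc n ×ᴿ 1#)       ≈⟨ ⁻¹-∙-comm _ _ ⟨
    - (suc m ×ᴿ 1#) - suc n ×ᴿ 1#       ∎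

  ι-*ˡ : ∀ m j → ι (+ m ℤ.* j) ≈ ι (+ m) * ι j
  ι-*ˡ m (+ n) = ≈.trans (≈.reflexive (cong ι (sym (ℤ.pos-* m n)))) (×1-homo-* m n)
  ι-*ˡ m -[1+ n ] = begin
    ι (+ m ℤ.* -[1+ n ])         ≡⟨ cong ι (ℤ.neg-distribʳ-* (+ m) (+ suc n)) ⟨
    ι (ℤ.- (+ m ℤ.* + suc n))    ≈⟨ ι-neg (+ m ℤ.* + suc n) ⟩
    - ι (+ m ℤ.* + suc n)        ≈⟨ -‿cong (ι-*ˡ m (+ suc n)) ⟩
    - (ι (+ m) * ι (+ suc n))    ≈⟨ -‿distribʳ-* _ _ ⟩
    ι (+ m) * ι -[1+ n ]         ∎

  ι-* : ∀ i j → ι (i ℤ.* j) ≈ ι i * ι j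
  ι-* (+ m)    j = ι-*ˡ m j
  ι-* -[1+ m ] j = begin
    ι (-[1+ m ] ℤ.* j)           ≡⟨ cong ι (ℤ.neg-distribˡ-* (+ suc m) j) ⟨
    ι (ℤ.- (+ suc m ℤ.* j))      ≈⟨ ι-neg (+ suc m ℤ.* j) ⟩
    - ι (+ suc m ℤ.* j)          ≈⟨ -‿cong (ι-*ˡ (suc m) j) ⟩
    - (ι (+ suc m) * ι j)        ≈⟨ -‿distribˡ-* _ _ ⟩
    ι -[1+ m ] * ι j             ∎

  ι-morphism : ℤ.+-*-rawRing -Raw-AlmostCommutative⟶ fromCommutativeRing R
  ι-morphism = record
    { ⟦_⟧ = ι ; +-homo = ι-+ ; *-homo = ι-* ; -‿homo = ι-neg ; 0-homo = ≈.refl ; 1-homo = ≈.refl }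

  open Algebra.Solver.Ring ℤ.+-*-rawRing (fromCommutativeRing R) ι-morphism
    (λ i j → Maybe.map (λ i≡j → ≈.reflexive (cong ι i≡j)) (dec⇒maybe (i ℤ.≟ j))) public hiding (solve)
  open Reflection setoid var ⟦_⟧ ⟦_⟧↓ correct using (close)

  -- Comparing the normal forms themselves is much faster than comparing their
  -- values in R, as the solver of the library does.
  solve : ∀ n (f : N-ary n (Polynomial n) (Polynomial n × Polynomial n)) →
    normalise (proj₁ (close n f)) ≡ normalise (proj₂ (close n f)) →
    Eq n _≈_ (curryⁿ (⟦ proj₁ (close n f) ⟧)) (curryⁿ (⟦ proj₂ (close n f) ⟧))
  solve n f eq = curryⁿ-cong _≈_ ⟦ p ⟧ ⟦ p′ ⟧ λ ρ → begin
    ⟦ p ⟧ ρ               ≈⟨ correct p ρ ⟨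
    ⟦ normalise p ⟧N ρ    ≡⟨ cong (λ n → ⟦ n ⟧N ρ) eq ⟩
    ⟦ normalise p′ ⟧N ρ   ≈⟨ correct p′ ρ ⟩
    ⟦ p′ ⟧ ρ              ∎
    where
    p  = proj₁ (close n f)
    p′ = proj₂ (close n f)

-- Squaring on the circle over a finite field of odd order

module OddFiniteField
  {a} {A : Set a} {_+_ _*_ : Op₂ A} { -_ : Op₁ A} {0# 1# : A}
  (isCommutativeRing : IsCommutativeRing _≡_ _+_ _*_ -_ 0# 1#)
  (1≢0 : 1# ≢ 0#)
  (inverse : ∀ x → x ≢ 0# → ∃[ y ] x * y ≡ 1#)
  (_≟_ : DecidableEquality A)
  (elements : List A) (elements! : Unique elements) (∈elements : ∀ x → x ∈ elements)
  (odd-order : ¬ 2 ∣ length elements)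
  where

  R : CommutativeRing a a
  R = record { isCommutativeRing = isCommutativeRing }

  open CommutativeRing R
    using (_-_; ring; +-identityˡ; *-identityˡ; zeroˡ; zeroʳ)
  open RingProperties ring using (-0#≈0#)
  open IntegerSolver R using (solve; _:=_; _:+_; _:*_; :-_; _:-_; con)
  open ≡-Reasoning

  2# : A
  2# = 1# + 1#

  x-y≡0⇒x≡y : ∀ {x y} → x - y ≡ 0# → x ≡ y
  x-y≡0⇒x≡y {x} {y} eq = begin
    x             ≡⟨ solve 2 (λ x y → x := (x :- y) :+ y) refl x y ⟩
    (x - y) + y   ≡⟨ cong (_+ y) eq ⟩
    0# + y        ≡⟨ +-identityˡ y ⟩
    y             ∎

  x≡y⇒x-y≡0 : ∀ {x y} → x ≡ y → x - y ≡ 0#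
  x≡y⇒x-y≡0 {x} refl = solve 1 (λ x → x :- x := con 0ℤ) refl x

  -- To deduce x ≡ y from e ≡ e′ exhibit x - y as a multiple of e - e′.
  by-multiple : ∀ k {e e′ x y} → e ≡ e′ → x - y ≡ k * (e - e′) → x ≡ y
  by-multiple k e≡e′ eq = x-y≡0⇒x≡y (trans eq (trans (cong (k *_) (x≡y⇒x-y≡0 e≡e′)) (zeroʳ k)))

  by-combination : ∀ k l {d d′ e e′ x y} → d ≡ d′ → e ≡ e′ →
    x - y ≡ (k * (d - d′)) + (l * (e - e′)) → x ≡ y
  by-combination k l d≡d′ e≡e′ eq = x-y≡0⇒x≡y (trans eq (trans
    (cong₂ _+_ (trans (cong (k *_) (x≡y⇒x-y≡0 d≡d′)) (zeroʳ k)) (trans (cong (l *_) (x≡y⇒x-y≡0 e≡e′)) (zeroʳ l)))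
    (+-identityˡ 0#)))

  *-cancelˡ : ∀ {k x y} → k ≢ 0# → k * x ≡ k * y → x ≡ y
  *-cancelˡ {k} {x} {y} k≢0 eq with i , ki≡1 ← inverse k k≢0 =
    by-combination i (y - x) eq ki≡1
      (solve 4 (λ k i x y → x :- y := i :* (k :* x :- k :* y) :+ (y :- x) :* (k :* i :- con 1ℤ)) refl k i x y)

  integral : ∀ {x y} → x * y ≡ 0# → x ≡ 0# ⊎ y ≡ 0#
  integral {x} {y} eq with x ≟ 0#
  ... | yes x≡0 = inj₁ x≡0
  ... | no  x≢0 = inj₂ (*-cancelˡ x≢0 (trans eq (sym (zeroʳ x))))

  square≡0 : ∀ {x} → x * x ≡ 0# → x ≡ 0#
  square≡0 eq = [ id , id ]′ (integral eq)

  square-roots : ∀ {x y} → x * x ≡ y * y → y ≡ x ⊎ y ≡ - x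
  square-roots {x} {y} eq = Sum.map x-y≡0⇒x≡y
    (λ y+x≡0 → by-multiple 1# y+x≡0
      (solve 2 (λ x y → y :- (:- x) := con 1ℤ :* (y :+ x :- con 0ℤ)) refl x y))
    (integral {y - x} {y + x} (trans
      (solve 2 (λ x y → (y :- x) :* (y :+ x) := y :* y :- x :* x) refl x y)
      (x≡y⇒x-y≡0 (sym eq))))

  -- In characteristic 2 the involution x ↦ x + 1 would have no fixed points.
  2≢0 : 2# ≢ 0#
  2≢0 2≡0 = odd-order (divides (length (image _≟_ _≟_ f elements)) (begin
    length elements                              ≡⟨ ℕ.+-identityʳ _ ⟨
    length elements ℕ.+ 0                        ≡⟨ cong (λ zs → length elements ℕ.+ length zs)
      (filter-none (fixed? _≟_ _≟_ f σ) {xs = elements} (All.tabulate (λ _ → σ-free))) ⟨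
    length elements ℕ.+ length (filter (fixed? _≟_ _≟_ f σ) elements)
      ≡⟨ image-orbits _≟_ _≟_ f σ elements! (λ {x} _ → ∈elements _ , f∘σ x) (λ _ _ → fibre) ⟩
    2 ℕ.* length (image _≟_ _≟_ f elements)      ≡⟨ ℕ.*-comm 2 (length (image _≟_ _≟_ f elements)) ⟩
    length (image _≟_ _≟_ f elements) ℕ.* 2      ∎))
    where
    -- `f` is the Artin-Schreier map; when 2 vanishes its fibres are exactly the pairs `x`, `x + 1`.
    f σ : A → A
    f x = (x * x) + x
    σ x = x + 1#
    σ-free : ∀ {x} → σ x ≢ x
    σ-free {x} eq = 1≢0 (by-multiple 1# eq
      (solve 1 (λ x → con 1ℤ :- con 0ℤ := con 1ℤ :* (x :+ con 1ℤ :- x)) refl x))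
    f∘σ : ∀ x → f (σ x) ≡ f x
    f∘σ x = by-multiple (x + 1#) 2≡0
      (solve 1 (λ x → ((x :+ con 1ℤ) :* (x :+ con 1ℤ) :+ (x :+ con 1ℤ)) :- (x :* x :+ x)
        := (x :+ con 1ℤ) :* (con 1ℤ :+ con 1ℤ :- con 0ℤ)) refl x)
    fibre : ∀ {x y} → f x ≡ f y → y ≡ x ⊎ y ≡ σ x
    fibre {x} {y} eq = Sum.map x-y≡0⇒x≡y
      (λ y+x+1≡0 → by-combination 1# (- (x + 1#)) y+x+1≡0 2≡0
        (solve 2 (λ x y → y :- (x :+ con 1ℤ) := con 1ℤ :* (y :+ x :+ con 1ℤ :- con 0ℤ)
          :+ (:- (x :+ con 1ℤ)) :* (con 1ℤ :+ con 1ℤ :- con 0ℤ)) refl x y))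
      (integral {y - x} {(y + x) + 1#} (by-multiple (- 1#) eq
        (solve 2 (λ x y → (y :- x) :* (y :+ x :+ con 1ℤ) :- con 0ℤ
          := (:- con 1ℤ) :* ((x :* x :+ x) :- (y :* y :+ y))) refl x y)))

  ½ : A
  ½ = proj₁ (inverse 2# 2≢0)

  2½≡1 : 2# * ½ ≡ 1#
  2½≡1 = proj₂ (inverse 2# 2≢0)

  x+x≡0⇒x≡0 : ∀ {x} → x + x ≡ 0# → x ≡ 0#
  x+x≡0⇒x≡0 {x} eq = *-cancelˡ 2≢0 (by-multiple 1# eq
    (solve 1 (λ x → (con 1ℤ :+ con 1ℤ) :* x :- (con 1ℤ :+ con 1ℤ) :* con 0ℤ := con 1ℤ :* (x :+ x :- con 0ℤ)) refl x))

  -x≡x⇒x≡0 : ∀ {x} → - x ≡ x → x ≡ 0#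
  -x≡x⇒x≡0 {x} eq = x+x≡0⇒x≡0 (by-multiple (- 1#) eq
    (solve 1 (λ x → x :+ x :- con 0ℤ := (:- con 1ℤ) :* (:- x :- x)) refl x))

  -1≢1 : - 1# ≢ 1#
  -1≢1 = 1≢0 ∘ -x≡x⇒x≡0

  -- The group law of the circle

  Point : Set a
  Point = A × A

  _≟ₚ_ : DecidableEquality Point
  _≟ₚ_ = ≡-dec _≟_ _≟_

  norm : Point → A
  norm (x , y) = (x * x) + (y * y)

  -- Points are multiplied as the elements x + y i of A[i], where i² = - 1.
  infixl 7 _·_
  _·_ : Point → Point → Point
  (x , y) · (u , v) = ((x * u) - (y * v)) , ((x * v) + (y * u))

  conj neg D : Point → Point
  conj (x , y) = x , - y
  neg  (x , y) = - x , - y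
  D z = z · z

  one : Point
  one = 1# , 0#

  OnCircle : Point → Set a
  OnCircle z = norm z ≡ 1#

  norm-· : ∀ z w → norm (z · w) ≡ norm z * norm w
  norm-· (x , y) (u , v) = solve 4 (λ x y u v →
    (x :* u :- y :* v) :* (x :* u :- y :* v) :+ (x :* v :+ y :* u) :* (x :* v :+ y :* u)
    := (x :* x :+ y :* y) :* (u :* u :+ v :* v)) refl x y u v

  norm-conj : ∀ z → norm (conj z) ≡ norm z
  norm-conj (x , y) = solve 2 (λ x y → x :* x :+ (:- y) :* (:- y) := x :* x :+ y :* y) refl x y

  ·-onCircle : ∀ {z w} → OnCircle z → OnCircle w → OnCircle (z · w)
  ·-onCircle {z} {w} z∈ w∈ = trans (norm-· z w) (trans (cong₂ _*_ z∈ w∈) (*-identityˡ 1#))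

  ·-assoc : ∀ z w t → (z · w) · t ≡ z · (w · t)
  ·-assoc (x , y) (u , v) (r , s) = cong₂ _,_
    (solve 6 (λ x y u v r s → (x :* u :- y :* v) :* r :- (x :* v :+ y :* u) :* s
      := x :* (u :* r :- v :* s) :- y :* (u :* s :+ v :* r)) refl x y u v r s)
    (solve 6 (λ x y u v r s → (x :* u :- y :* v) :* s :+ (x :* v :+ y :* u) :* r
      := x :* (u :* s :+ v :* r) :+ y :* (u :* r :- v :* s)) refl x y u v r s)

  ·-comm : ∀ z w → z · w ≡ w · z
  ·-comm (x , y) (u , v) = cong₂ _,_
    (solve 4 (λ x y u v → x :* u :- y :* v := u :* x :- v :* y) refl x y u v)
    (solve 4 (λ x y u v → x :* v :+ y :* u := u :* y :+ v :* x) refl x y u v)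

  ·-identityˡ : ∀ z → one · z ≡ z
  ·-identityˡ (x , y) = cong₂ _,_
    (solve 2 (λ x y → con 1ℤ :* x :- con 0ℤ :* y := x) refl x y)
    (solve 2 (λ x y → con 1ℤ :* y :+ con 0ℤ :* x := y) refl x y)

  neg-· : ∀ z → neg one · z ≡ neg z
  neg-· (x , y) = cong₂ _,_
    (solve 2 (λ x y → (:- con 1ℤ) :* x :- (:- con 0ℤ) :* y := :- x) refl x y)
    (solve 2 (λ x y → (:- con 1ℤ) :* y :+ (:- con 0ℤ) :* x := :- y) refl x y)

  conj-inverse : ∀ {z} → OnCircle z → conj z · z ≡ one
  conj-inverse {x , y} z∈ = cong₂ _,_
    (trans (solve 2 (λ x y → x :* x :- (:- y) :* y := x :* x :+ y :* y) refl x y) z∈)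
    (solve 2 (λ x y → x :* y :+ (:- y) :* x := con 0ℤ) refl x y)

  D-· : ∀ z w → D (z · w) ≡ D z · D w
  D-· (x , y) (u , v) = cong₂ _,_
    (solve 4 (λ x y u v → (x :* u :- y :* v) :* (x :* u :- y :* v) :- (x :* v :+ y :* u) :* (x :* v :+ y :* u)
      := (x :* x :- y :* y) :* (u :* u :- v :* v) :- (x :* y :+ y :* x) :* (u :* v :+ v :* u)) refl x y u v)
    (solve 4 (λ x y u v → (x :* u :- y :* v) :* (x :* v :+ y :* u) :+ (x :* v :+ y :* u) :* (x :* u :- y :* v)
      := (x :* x :- y :* y) :* (u :* v :+ v :* u) :+ (x :* y :+ y :* x) :* (u :* u :- v :* v)) refl x y u v)

  D-conj : ∀ z → D (conj z) ≡ conj (D z)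
  D-conj (x , y) = cong₂ _,_
    (solve 2 (λ x y → x :* x :- (:- y) :* (:- y) := x :* x :- y :* y) refl x y)
    (solve 2 (λ x y → x :* (:- y) :+ (:- y) :* x := :- (x :* y :+ y :* x)) refl x y)

  D-neg : ∀ z → D (neg z) ≡ D z
  D-neg (x , y) = cong₂ _,_
    (solve 2 (λ x y → (:- x) :* (:- x) :- (:- y) :* (:- y) := x :* x :- y :* y) refl x y)
    (solve 2 (λ x y → (:- x) :* (:- y) :+ (:- y) :* (:- x) := x :* y :+ y :* x) refl x y)

  D-one : D one ≡ one
  D-one = ·-identityˡ one

  -- Subtracting `x² - y² = 1` from `x² + y² = 1` leaves `2 y² = 0`.
  D-kernel : ∀ {z} → OnCircle z → D z ≡ one → z ≡ one ⊎ z ≡ neg one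
  D-kernel {x , y} z∈ Dz≡1 = Sum.map
    (λ x≡1 → cong₂ _,_ x≡1 y≡0)
    (λ x≡-1 → cong₂ _,_ x≡-1 (trans y≡0 (sym -0#≈0#)))
    (square-roots (by-combination (- 1#) y z∈ y≡0
      (solve 2 (λ x y → con 1ℤ :* con 1ℤ :- x :* x
        := (:- con 1ℤ) :* (x :* x :+ y :* y :- con 1ℤ) :+ y :* (y :- con 0ℤ)) refl x y)))
    where
    y≡0 : y ≡ 0#
    y≡0 = square≡0 (x+x≡0⇒x≡0 (by-combination 1# (- 1#) z∈ (cong proj₁ Dz≡1)
      (solve 2 (λ x y → y :* y :+ y :* y :- con 0ℤ := con 1ℤ :* (x :* x :+ y :* y :- con 1ℤ)
        :+ (:- con 1ℤ) :* (x :* x :- y :* y :- con 1ℤ)) refl x y)))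

  -- The quotient `w · conj z` doubles to `one`. The second alternative keeps this quotient, since a
  -- subgroup containing `z` and `w` then contains `neg one`.
  D-fibre : ∀ {z w} → OnCircle z → OnCircle w → D z ≡ D w → w ≡ z ⊎ (w ≡ neg z × w · conj z ≡ neg one)
  D-fibre {z} {w} z∈ w∈ eq = Sum.map
    (λ q≡1  → trans w≡qz (trans (cong (_· z) q≡1) (·-identityˡ z)))
    (λ q≡-1 → trans w≡qz (trans (cong (_· z) q≡-1) (neg-· z)) , q≡-1)
    (D-kernel (·-onCircle w∈ (trans (norm-conj z) z∈)) (begin
      D (w · conj z)       ≡⟨ D-· w (conj z) ⟩
      D w · D (conj z)     ≡⟨ cong₂ _·_ (sym eq) (D-conj z) ⟩
      D z · conj (D z)     ≡⟨ ·-comm (D z) (conj (D z)) ⟩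
      conj (D z) · D z     ≡⟨ conj-inverse (·-onCircle z∈ z∈) ⟩
      one                  ∎))
    where
    w≡qz : w ≡ (w · conj z) · z
    w≡qz = begin
      w                    ≡⟨ ·-identityˡ w ⟨
      one · w              ≡⟨ ·-comm one w ⟩
      w · one              ≡⟨ cong (w ·_) (conj-inverse z∈) ⟨
      w · (conj z · z)     ≡⟨ ·-assoc w (conj z) z ⟨
      (w · conj z) · z     ∎

  neg≢id : ∀ {z} → OnCircle z → neg z ≢ z
  neg≢id {x , y} z∈ eq = 1≢0 (by-combination x y x≡0 y≡0′
    (trans (cong (_- 0#) (sym z∈))
      (solve 2 (λ x y → x :* x :+ y :* y :- con 0ℤ := x :* (x :- con 0ℤ) :+ y :* (y :- con 0ℤ)) refl x y)))
    where
    x≡0 : x ≡ 0#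
    x≡0 = -x≡x⇒x≡0 (cong proj₁ eq)
    y≡0′ : y ≡ 0#
    y≡0′ = -x≡x⇒x≡0 (cong proj₂ eq)

  norm-neg : ∀ z → norm (neg z) ≡ norm z
  norm-neg (x , y) = solve 2 (λ x y → (:- x) :* (:- x) :+ (:- y) :* (:- y) := x :* x :+ y :* y) refl x y

  one-onCircle : OnCircle one
  one-onCircle = solve 0 (con 1ℤ :* con 1ℤ :+ con 0ℤ :* con 0ℤ := con 1ℤ) refl

  neg-one≢one : neg one ≢ one
  neg-one≢one = -1≢1 ∘ cong proj₁

  conj-involutive : ∀ z → conj (conj z) ≡ z
  conj-involutive (x , y) = cong (x ,_) (solve 1 (λ y → :- (:- y) := y) refl y)

  conj-fixed : ∀ {z} → OnCircle z → conj z ≡ z → z ≡ one ⊎ z ≡ neg one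
  conj-fixed {z} z∈ eq = D-kernel z∈ (trans (cong (_· z) (sym eq)) (conj-inverse z∈))

  -- The projection of the circle to the values of w

  f : A → A
  f w = (w * w) - 2#

  π : Point → A
  π (x , y) = x + x

  -- The duplication formula `(2 cos θ)² - 2 = 2 cos 2θ`.
  f∘π : ∀ {z} → OnCircle z → f (π z) ≡ π (D z)
  f∘π {x , y} z∈ = by-multiple 2# z∈
    (solve 2 (λ x y → ((x :+ x) :* (x :+ x) :- (con 1ℤ :+ con 1ℤ)) :- ((x :* x :- y :* y) :+ (x :* x :- y :* y))
      := (con 1ℤ :+ con 1ℤ) :* (x :* x :+ y :* y :- con 1ℤ)) refl x y)

  π-conj : ∀ z → π (conj z) ≡ π z
  π-conj z = refl

  π-fibre : ∀ {z w} → OnCircle z → OnCircle w → π z ≡ π w → w ≡ z ⊎ w ≡ conj z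
  π-fibre {x , y} {u , v} z∈ w∈ eq = Sum.map (cong₂ _,_ u≡x) (cong₂ _,_ u≡x)
    (square-roots (by-combination 1# (- (x + u)) (trans z∈ (sym w∈)) (sym u≡x)
      (solve 4 (λ x y u v → y :* y :- v :* v := con 1ℤ :* ((x :* x :+ y :* y) :- (u :* u :+ v :* v))
         :+ (:- (x :+ u)) :* (x :- u)) refl x y u v)))
    where
    u≡x : u ≡ x
    u≡x = *-cancelˡ 2≢0 (by-multiple (- 1#) eq
      (solve 2 (λ x u → (con 1ℤ :+ con 1ℤ) :* u :- (con 1ℤ :+ con 1ℤ) :* x
        := (:- con 1ℤ) :* ((x :+ x) :- (u :+ u))) refl x u))

  -- On the circle `conj` is inversion, so `conj-closed` is closure under inverses.
  record IsSubgroup (H : List Point) : Set a where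
    field
      unique      : Unique H
      onCircle    : ∀ {z} → z ∈ H → OnCircle z
      one∈        : one ∈ H
      ·-closed    : ∀ {z w} → z ∈ H → w ∈ H → z · w ∈ H
      conj-closed : ∀ {z} → z ∈ H → conj z ∈ H

    neg-closed : neg one ∈ H → ∀ {z} → z ∈ H → neg z ∈ H
    neg-closed -1∈ z∈ = subst (_∈ H) (neg-· _) (·-closed -1∈ z∈)

  open IsSubgroup

  circle : List Point
  circle = filter (λ z → norm z ≟ 1#) (cartesianProduct elements elements)

  ∈-circle⁺ : ∀ {z} → OnCircle z → z ∈ circle
  ∈-circle⁺ {x , y} = ∈-filter⁺ (λ z → norm z ≟ 1#) (∈-cartesianProduct⁺ (∈elements x) (∈elements y))

  ∈-circle⁻ : ∀ {z} → z ∈ circle → OnCircle z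
  ∈-circle⁻ = proj₂ ∘ ∈-filter⁻ (λ z → norm z ≟ 1#) {xs = cartesianProduct elements elements}

  circle-isSubgroup : IsSubgroup circle
  circle-isSubgroup = record
    { unique      = Unique.filter⁺ (λ z → norm z ≟ 1#) (Unique.cartesianProduct⁺ elements! elements!)
    ; onCircle    = ∈-circle⁻
    ; one∈        = ∈-circle⁺ one-onCircle
    ; ·-closed    = λ z∈ w∈ → ∈-circle⁺ (·-onCircle (∈-circle⁻ z∈) (∈-circle⁻ w∈))
    ; conj-closed = λ {z} z∈ → ∈-circle⁺ (trans (norm-conj z) (∈-circle⁻ z∈))
    }

  imageD : List Point → List Point
  imageD = image _≟ₚ_ _≟ₚ_ D

  imageπ : List Point → List A
  imageπ = image _≟ₚ_ _≟_ π

  imageD-isSubgroup : ∀ {H} → IsSubgroup H → IsSubgroup (imageD H)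
  imageD-isSubgroup {H} S = record
    { unique      = image-unique _≟ₚ_ _≟ₚ_ D H
    ; onCircle    = onCircle′
    ; one∈        = subst (_∈ imageD H) D-one (∈-image⁺ _≟ₚ_ _≟ₚ_ D (one∈ S))
    ; ·-closed    = ·-closed′
    ; conj-closed = conj-closed′
    }
    where
    onCircle′ : ∀ {z} → z ∈ imageD H → OnCircle z
    onCircle′ z∈ with z , z∈ , refl ← ∈-image⁻ _≟ₚ_ _≟ₚ_ D {H} z∈ = ·-onCircle (onCircle S z∈) (onCircle S z∈)
    ·-closed′ : ∀ {z w} → z ∈ imageD H → w ∈ imageD H → z · w ∈ imageD H
    ·-closed′ z∈ w∈
      with z , z∈ , refl ← ∈-image⁻ _≟ₚ_ _≟ₚ_ D {H} z∈
         | w , w∈ , refl ← ∈-image⁻ _≟ₚ_ _≟ₚ_ D {H} w∈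
      = subst (_∈ imageD H) (D-· z w) (∈-image⁺ _≟ₚ_ _≟ₚ_ D (·-closed S z∈ w∈))
    conj-closed′ : ∀ {z} → z ∈ imageD H → conj z ∈ imageD H
    conj-closed′ z∈ with z , z∈ , refl ← ∈-image⁻ _≟ₚ_ _≟ₚ_ D {H} z∈ =
      subst (_∈ imageD H) (D-conj z) (∈-image⁺ _≟ₚ_ _≟ₚ_ D (conj-closed S z∈))

  ∣imageD∣ : ∀ {H} → IsSubgroup H → neg one ∈ H → length H ≡ 2 ℕ.* length (imageD H)
  ∣imageD∣ {H} S -1∈ = begin
    length H                                     ≡⟨ ℕ.+-identityʳ _ ⟨
    length H ℕ.+ 0                               ≡⟨ cong (λ zs → length H ℕ.+ length zs)
      (filter-none (fixed? _≟ₚ_ _≟ₚ_ D neg) {xs = H} (All.tabulate (neg≢id ∘ onCircle S))) ⟨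
    length H ℕ.+ length (filter (fixed? _≟ₚ_ _≟ₚ_ D neg) H)
      ≡⟨ image-orbits _≟ₚ_ _≟ₚ_ D neg (unique S)
           (λ {z} z∈ → neg-closed S -1∈ z∈ , D-neg z)
           (λ z∈ w∈ eq → Sum.map₂ proj₁ (D-fibre (onCircle S z∈) (onCircle S w∈) eq)) ⟩
    2 ℕ.* length (imageD H)                      ∎

  ∣imageπ∣ : ∀ {H} → IsSubgroup H →
    length H ℕ.+ length (filter (fixed? _≟ₚ_ _≟_ π conj) H) ≡ 2 ℕ.* length (imageπ H)
  ∣imageπ∣ S = image-orbits _≟ₚ_ _≟_ π conj (unique S)
    (λ {z} z∈ → conj-closed S z∈ , π-conj z)
    (λ z∈ w∈ → π-fibre (onCircle S z∈) (onCircle S w∈))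

  conj-one : conj one ≡ one
  conj-one = cong (1# ,_) -0#≈0#

  -- A fixed point of `conj` is its own inverse, hence `one` or `neg one`; here `H` contains both.
  ∣imageπ∣-even : ∀ {H} → IsSubgroup H → neg one ∈ H → length H ℕ.+ 2 ≡ 2 ℕ.* length (imageπ H)
  ∣imageπ∣-even {H} S -1∈ = trans (cong (length H ℕ.+_) (sym
    (sameElements⇒length≡ (Unique.filter⁺ (fixed? _≟ₚ_ _≟_ π conj) (unique S))
      (((neg-one≢one ∘ sym) ∷ []) ∷ [] ∷ []) ⊆ ⊇))) (∣imageπ∣ S)
    where
    ⊆ : ∀ {z} → z ∈ filter (fixed? _≟ₚ_ _≟_ π conj) H → z ∈ one ∷ neg one ∷ []
    ⊆ z∈ = [ here , (λ z≡-1 → there (here z≡-1)) ]′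
      (conj-fixed (onCircle S (proj₁ (∈fixed z∈))) (proj₂ (∈fixed z∈)))
      where ∈fixed = ∈-filter⁻ (fixed? _≟ₚ_ _≟_ π conj) {xs = H}
    ⊇ : ∀ {z} → z ∈ one ∷ neg one ∷ [] → z ∈ filter (fixed? _≟ₚ_ _≟_ π conj) H
    ⊇ (here refl)         = ∈-filter⁺ (fixed? _≟ₚ_ _≟_ π conj) (one∈ S) conj-one
    ⊇ (there (here refl)) = ∈-filter⁺ (fixed? _≟ₚ_ _≟_ π conj) -1∈ (cong (- 1# ,_) (cong -_ -0#≈0#))

  ∣imageπ∣-odd : ∀ {H} → IsSubgroup H → neg one ∉ H → length H ℕ.+ 1 ≡ 2 ℕ.* length (imageπ H)
  ∣imageπ∣-odd {H} S -1∉ = trans (cong (length H ℕ.+_) (sym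
    (sameElements⇒length≡ (Unique.filter⁺ (fixed? _≟ₚ_ _≟_ π conj) (unique S)) ([] ∷ []) ⊆ ⊇))) (∣imageπ∣ S)
    where
    ⊆ : ∀ {z} → z ∈ filter (fixed? _≟ₚ_ _≟_ π conj) H → z ∈ one ∷ []
    ⊆ z∈ = [ here , (λ z≡-1 → contradiction (subst (_∈ H) z≡-1 (proj₁ (∈fixed z∈))) -1∉) ]′
      (conj-fixed (onCircle S (proj₁ (∈fixed z∈))) (proj₂ (∈fixed z∈)))
      where ∈fixed = ∈-filter⁻ (fixed? _≟ₚ_ _≟_ π conj) {xs = H}
    ⊇ : ∀ {z} → z ∈ one ∷ [] → z ∈ filter (fixed? _≟ₚ_ _≟_ π conj) H
    ⊇ (here refl) = ∈-filter⁺ (fixed? _≟ₚ_ _≟_ π conj) (one∈ S) conj-one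

  -- Periodic points of doubling

  D^-onCircle : ∀ m {z} → OnCircle z → OnCircle (fold z D m)
  D^-onCircle zero    z∈ = z∈
  D^-onCircle (suc m) z∈ = ·-onCircle (D^-onCircle m z∈) (D^-onCircle m z∈)

  D^-periodic : ∀ m {z} → Periodic D z → Periodic D (fold z D m)
  D^-periodic m {z} (k , 0<k , eq) = k , 0<k , (begin
    fold (fold z D m) D k   ≡⟨ fold-+ z D k ⟨
    fold z D (k ℕ.+ m)      ≡⟨ cong (fold z D) (ℕ.+-comm k m) ⟩
    fold z D (m ℕ.+ k)      ≡⟨ fold-+ z D m ⟩
    fold (fold z D k) D m   ≡⟨ cong (λ w → fold w D m) eq ⟩
    fold z D m              ∎)

  -- `-1∉` encodes that `H` has odd order: `neg one` is the only element of order 2. In this form it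
  -- gives the injectivity of `D` on `H` directly, hence the converse of `periodic⇒∈`.
  record OddPart : Set a where
    field
      {H}        : List Point
      isSubgroup : IsSubgroup H
      -1∉        : neg one ∉ H
      {s}        : ℕ
      order      : length circle ≡ 2 ℕ.^ s ℕ.* length H
      periodic⇒∈ : ∀ {z} → OnCircle z → Periodic D z → z ∈ H

  open DecMembership _≟ₚ_ using () renaming (_∈?_ to _∈ₚ?_)

  -- As long as `neg one` remains in `H`, passing to `imageD H` halves the order and loses no
  -- periodic point: a periodic point is the double of its predecessor in its cycle, which is
  -- periodic too. `bound` makes the recursion structural.
  oddPart-below : ∀ bound {H} s → IsSubgroup H → length H ≤ bound → length circle ≡ 2 ℕ.^ s ℕ.* length H →
    (∀ {z} → OnCircle z → Periodic D z → z ∈ H) → OddPart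
  oddPart-below bound {H} s S H≤ order per with neg one ∈ₚ? H
  ... | no -1∉ = record { isSubgroup = S ; s = s ; -1∉ = -1∉ ; order = order ; periodic⇒∈ = per }
  oddPart-below zero {H} s S H≤ order per | yes -1∈ with [] ← H | () ← one∈ S
  oddPart-below (suc bound) {H} s S H≤ order per | yes -1∈ =
    oddPart-below bound (suc s) (imageD-isSubgroup S) H′≤ order′ per′
    where
    h′ : ℕ
    h′ = length (imageD H)
    0<length : ∀ {zs : List Point} {z} → z ∈ zs → 0 < length zs
    0<length (here _)  = s≤s z≤n
    0<length (there _) = s≤s z≤n
    H′≤ : h′ ≤ bound
    H′≤ = ℕ.s≤s⁻¹ (ℕ.<-≤-trans
      (ℕ.m<m*n h′ 2 {{ℕ.>-nonZero (0<length (one∈ (imageD-isSubgroup S)))}} (s≤s (s≤s z≤n)))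
      (ℕ.≤-trans (ℕ.≤-reflexive (trans (ℕ.*-comm h′ 2) (sym (∣imageD∣ S -1∈)))) H≤))
    order′ : length circle ≡ 2 ℕ.^ suc s ℕ.* h′
    order′ = begin
      length circle                 ≡⟨ order ⟩
      2 ℕ.^ s ℕ.* length H          ≡⟨ cong (2 ℕ.^ s ℕ.*_) (∣imageD∣ S -1∈) ⟩
      2 ℕ.^ s ℕ.* (2 ℕ.* h′)        ≡⟨ ℕ.*-assoc (2 ℕ.^ s) 2 h′ ⟨
      2 ℕ.^ s ℕ.* 2 ℕ.* h′          ≡⟨ cong (ℕ._* h′) (ℕ.*-comm (2 ℕ.^ s) 2) ⟩
      2 ℕ.^ suc s ℕ.* h′            ∎
    per′ : ∀ {z} → OnCircle z → Periodic D z → z ∈ imageD H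
    per′ {z} z∈ p@(suc m , _ , eq) = subst (_∈ imageD H) eq
      (∈-image⁺ _≟ₚ_ _≟ₚ_ D (per (D^-onCircle m z∈) (D^-periodic m p)))

  -- Abstract, since conversion checking would otherwise unfold the search.
  abstract
    oddPart : OddPart
    oddPart = oddPart-below (length circle) 0 circle-isSubgroup ℕ.≤-refl (sym (ℕ.*-identityˡ _)) (λ z∈ _ → ∈-circle⁺ z∈)

  -- The order of the circle by stereographic projection

  denominator : A → A
  denominator t = 1# + (t * t)

  slopes : List A
  slopes = filter (λ t → ¬? (denominator t ≟ 0#)) elements

  -- Made total so that `stereographic` is a function on all of `A`; on `slopes` the default 0 is
  -- never taken.
  reciprocal : A → A
  reciprocal x with x ≟ 0#
  ... | yes _  = 0#
  ... | no x≢0 = proj₁ (inverse x x≢0)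

  reciprocal-inverse : ∀ {x} → x ≢ 0# → x * reciprocal x ≡ 1#
  reciprocal-inverse {x} x≢0 with x ≟ 0#
  ... | yes x≡0 = contradiction x≡0 x≢0
  ... | no x≢0′ = proj₂ (inverse x x≢0′)

  -- The second intersection of the circle with the line of slope t through (- 1 , 0).
  stereographic : A → Point
  stereographic t = ((1# - (t * t)) * u) , ((2# * t) * u)
    where u = reciprocal (denominator t)

  ∈-slopes : ∀ {t} → t ∈ slopes → denominator t * reciprocal (denominator t) ≡ 1#
  ∈-slopes t∈ = reciprocal-inverse (proj₂ (∈-filter⁻ (λ t → ¬? (denominator t ≟ 0#)) {xs = elements} t∈))

  module _ (t u : A) (du≡1 : (1# + (t * t)) * u ≡ 1#) where

    stereographic-onCircle : OnCircle (((1# - (t * t)) * u) , ((2# * t) * u))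
    stereographic-onCircle = by-multiple (((1# + (t * t)) * u) + 1#) du≡1
      (solve 2 (λ t u → ((con 1ℤ :- t :* t) :* u) :* ((con 1ℤ :- t :* t) :* u)
          :+ (((con 1ℤ :+ con 1ℤ) :* t) :* u) :* (((con 1ℤ :+ con 1ℤ) :* t) :* u) :- con 1ℤ
        := ((con 1ℤ :+ t :* t) :* u :+ con 1ℤ) :* ((con 1ℤ :+ t :* t) :* u :- con 1ℤ)) refl t u)

    -- This recovers `u` from the first coordinate of the point, which yields injectivity, and shows
    -- that this coordinate is never - 1.
    2u≡1+x : 2# * u ≡ 1# + ((1# - (t * t)) * u)
    2u≡1+x = by-multiple 1# du≡1
      (solve 2 (λ t u → (con 1ℤ :+ con 1ℤ) :* u :- (con 1ℤ :+ (con 1ℤ :- t :* t) :* u)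
        := con 1ℤ :* ((con 1ℤ :+ t :* t) :* u :- con 1ℤ)) refl t u)

    u≢0 : u ≢ 0#
    u≢0 u≡0 = 1≢0 (trans (sym du≡1) (trans (cong ((1# + (t * t)) *_) u≡0) (zeroʳ _)))

  stereographic-injective : ∀ {t t′} → t ∈ slopes → t′ ∈ slopes → stereographic t ≡ stereographic t′ → t ≡ t′
  stereographic-injective {t} {t′} t∈ t′∈ eq = *-cancelˡ (u≢0 t u (∈-slopes t∈)) (*-cancelˡ 2≢0 (begin
    2# * (u * t)     ≡⟨ rearrange u t ⟩
    (2# * t) * u     ≡⟨ cong proj₂ eq ⟩
    (2# * t′) * u′   ≡⟨ cong ((2# * t′) *_) u≡u′ ⟨
    (2# * t′) * u    ≡⟨ rearrange u t′ ⟨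
    2# * (u * t′)    ∎))
    where
    u = reciprocal (denominator t)
    u′ = reciprocal (denominator t′)
    rearrange : ∀ u t → 2# * (u * t) ≡ (2# * t) * u
    rearrange = solve 2 (λ u t → (con 1ℤ :+ con 1ℤ) :* (u :* t) := ((con 1ℤ :+ con 1ℤ) :* t) :* u) refl
    u≡u′ : u ≡ u′
    u≡u′ = *-cancelˡ 2≢0 (trans (2u≡1+x t u (∈-slopes t∈))
      (trans (cong (λ z → 1# + proj₁ z) eq) (sym (2u≡1+x t′ u′ (∈-slopes t′∈)))))

  stereographic≢neg-one : ∀ {t} → t ∈ slopes → neg one ≢ stereographic t
  stereographic≢neg-one {t} t∈ eq = u≢0 t u (∈-slopes t∈) (*-cancelˡ 2≢0 (begin
    2# * u                        ≡⟨ 2u≡1+x t u (∈-slopes t∈) ⟩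
    1# + ((1# - (t * t)) * u)     ≡⟨ cong (λ z → 1# + proj₁ z) eq ⟨
    1# - 1#                       ≡⟨ x≡y⇒x-y≡0 refl ⟩
    0#                            ≡⟨ zeroʳ 2# ⟨
    2# * 0#                       ∎))
    where u = reciprocal (denominator t)

  module _ {x y v : A} (z∈ : OnCircle (x , y)) (v-inv : (1# + x) * v ≡ 1#) where

    private
      t : A
      t = y * v

    -- On the circle `y² = (1 - x) (1 + x)`, so `t²` is `(1 - x) / (1 + x)`. As 2 is not 0, the
    -- denominator of this slope does not vanish.
    slope-inverse : denominator t * (1# + x) ≡ 2#
    slope-inverse = by-combination v (((y * y) * v) + (1# - x)) z∈ v-inv
      (solve 3 (λ x y v → (con 1ℤ :+ (y :* v) :* (y :* v)) :* (con 1ℤ :+ x) :- (con 1ℤ :+ con 1ℤ)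
        := v :* (x :* x :+ y :* y :- con 1ℤ)
          :+ ((y :* y) :* v :+ (con 1ℤ :- x)) :* ((con 1ℤ :+ x) :* v :- con 1ℤ)) refl x y v)

    slope∈ : t ∈ slopes
    slope∈ = ∈-filter⁺ (λ t → ¬? (denominator t ≟ 0#)) (∈elements t)
      (λ d≡0 → 2≢0 (trans (sym slope-inverse) (trans (cong (_* (1# + x)) d≡0) (zeroˡ _))))

    stereographic-slope : (x , y) ≡ stereographic t
    stereographic-slope = sym (cong₂ _,_
      (by-combination 1# (- 1#) 2u≡ (∈-slopes slope∈)
        (solve 3 (λ x t u → (con 1ℤ :- t :* t) :* u :- x
          := con 1ℤ :* ((con 1ℤ :+ con 1ℤ) :* u :- (con 1ℤ :+ x))
            :+ (:- con 1ℤ) :* ((con 1ℤ :+ t :* t) :* u :- con 1ℤ)) refl x t u))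
      (by-combination t y 2u≡ v-inv
        (solve 4 (λ x y v u → ((con 1ℤ :+ con 1ℤ) :* (y :* v)) :* u :- y
          := (y :* v) :* ((con 1ℤ :+ con 1ℤ) :* u :- (con 1ℤ :+ x))
            :+ y :* ((con 1ℤ :+ x) :* v :- con 1ℤ)) refl x y v u)))
      where
      u = reciprocal (denominator t)
      2u≡ : 2# * u ≡ 1# + x
      2u≡ = by-combination (- u) (1# + x) slope-inverse (∈-slopes slope∈)
        (solve 3 (λ x d u → (con 1ℤ :+ con 1ℤ) :* u :- (con 1ℤ :+ x)
          := (:- u) :* (d :* (con 1ℤ :+ x) :- (con 1ℤ :+ con 1ℤ)) :+ (con 1ℤ :+ x) :* (d :* u :- con 1ℤ))
          refl x (denominator t) u)

  ∣circle∣-slopes : length circle ≡ 1 ℕ.+ length slopes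
  ∣circle∣-slopes = trans
    (sameElements⇒length≡ (unique circle-isSubgroup)
      (All.map⁺ (All.tabulate stereographic≢neg-one) ∷ unique-map stereographic slopes! stereographic-injective) ⊆ ⊇)
    (cong suc (length-map stereographic slopes))
    where
    slopes! : Unique slopes
    slopes! = Unique.filter⁺ (λ t → ¬? (denominator t ≟ 0#)) elements!
    ⊆ : ∀ {z} → z ∈ circle → z ∈ neg one ∷ map stereographic slopes
    ⊆ {x , y} z∈ with (1# + x) ≟ 0#
    ... | yes 1+x≡0 = here (cong₂ _,_ x≡-1 (trans y≡0 (sym -0#≈0#)))
      where
      x≡-1 : x ≡ - 1#
      x≡-1 = by-multiple 1# 1+x≡0 (solve 1 (λ x → x :- (:- con 1ℤ) := con 1ℤ :* (con 1ℤ :+ x :- con 0ℤ)) refl x)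
      y≡0 : y ≡ 0#
      y≡0 = square≡0 (by-combination 1# (1# - x) (∈-circle⁻ z∈) 1+x≡0
        (solve 2 (λ x y → y :* y :- con 0ℤ := con 1ℤ :* (x :* x :+ y :* y :- con 1ℤ)
          :+ (con 1ℤ :- x) :* (con 1ℤ :+ x :- con 0ℤ)) refl x y))
    ... | no  1+x≢0 = there (subst (_∈ map stereographic slopes)
      (sym (stereographic-slope (∈-circle⁻ z∈) (proj₂ (inverse _ 1+x≢0))))
      (∈-map⁺ stereographic (slope∈ (∈-circle⁻ z∈) (proj₂ (inverse _ 1+x≢0)))))
    ⊇ : ∀ {z} → z ∈ neg one ∷ map stereographic slopes → z ∈ circle
    ⊇ (here refl) = ∈-circle⁺ (trans (norm-neg one) one-onCircle)
    ⊇ (there z∈) with t , t∈ , refl ← ∈-map⁻ stereographic z∈ =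
      ∈-circle⁺ (stereographic-onCircle t (reciprocal (denominator t)) (∈-slopes t∈))

  -- The excluded slopes are the square roots of - 1. Either there are none, or there are exactly
  -- two, `i` and `- i`, and the order drops from `q + 1` to `q - 1`.
  ∣circle∣ : length circle ≡ 1 ℕ.+ length elements ⊎ 1 ℕ.+ length circle ≡ length elements
  ∣circle∣ with any? (λ t → denominator t ≟ 0#) elements
  ... | no ¬root = inj₁ (trans ∣circle∣-slopes (cong suc (sameElements⇒length≡
    (Unique.filter⁺ P? elements!) elements! (λ _ → ∈elements _)
    (λ {t} t∈ → ∈-filter⁺ P? t∈ (λ d≡0 → ¬root (lose t∈ d≡0))))))
    where P? = λ t → ¬? (denominator t ≟ 0#)
  ... | yes root with i , _ , di≡0 ← find root = inj₂ (trans (cong suc ∣circle∣-slopes)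
    (sym (sameElements⇒length≡ elements!
      (((λ i≡-i → i≢0 (-x≡x⇒x≡0 (sym i≡-i))) ∷ root∉ di≡0) ∷ root∉ d-i≡0 ∷ Unique.filter⁺ P? elements!)
      (λ {t} _ → split t) (λ _ → ∈elements _))))
    where
    P? = λ t → ¬? (denominator t ≟ 0#)
    i≢0 : i ≢ 0#
    i≢0 refl = 1≢0 (trans (solve 0 (con 1ℤ := con 1ℤ :+ con 0ℤ :* con 0ℤ) refl) di≡0)
    d-i≡0 : denominator (- i) ≡ 0#
    d-i≡0 = trans (solve 1 (λ i → con 1ℤ :+ (:- i) :* (:- i) := con 1ℤ :+ i :* i) refl i) di≡0
    root∉ : ∀ {t} → denominator t ≡ 0# → All (t ≢_) slopes
    root∉ dt≡0 = All.tabulate λ { t∈ refl → proj₂ (∈-filter⁻ P? {xs = elements} t∈) dt≡0 }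
    split : ∀ t → t ∈ i ∷ - i ∷ slopes
    split t with denominator t ≟ 0#
    ... | no  d≢0 = there (there (∈-filter⁺ P? (∈elements t) d≢0))
    ... | yes d≡0 = [ here , (λ t≡-i → there (here t≡-i)) ]′
      (square-roots (by-combination 1# (- 1#) di≡0 d≡0
        (solve 2 (λ i t → i :* i :- t :* t := con 1ℤ :* (con 1ℤ :+ i :* i :- con 0ℤ)
          :+ (:- con 1ℤ) :* (con 1ℤ :+ t :* t :- con 0ℤ)) refl i t)))

  -- Periodicity above and below the projection

  π∘D^ : ∀ m {z} → OnCircle z → fold (π z) f m ≡ π (fold z D m)
  π∘D^ zero    z∈ = refl
  π∘D^ (suc m) z∈ = trans (cong f (π∘D^ m z∈)) (f∘π (D^-onCircle m z∈))

  D^-conj : ∀ m z → fold (conj z) D m ≡ conj (fold z D m)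
  D^-conj zero    z = refl
  D^-conj (suc m) z = trans (cong D (D^-conj m z)) (D-conj _)

  π-periodic⁺ : ∀ {z} → OnCircle z → Periodic D z → Periodic f (π z)
  π-periodic⁺ z∈ (m , 0<m , eq) = m , 0<m , trans (π∘D^ m z∈) (cong π eq)

  -- A cycle of length `m` below lifts to `D^m z = z` or `D^m z = conj z`. In the second case
  -- another `m` steps return to `z`, because `D` commutes with `conj`.
  π-periodic⁻ : ∀ {z} → OnCircle z → Periodic f (π z) → Periodic D z
  π-periodic⁻ {z} z∈ (m , 0<m , eq) =
    [ (λ D^z≡z → m , 0<m , D^z≡z)
    , (λ D^z≡z̄ → m ℕ.+ m , ℕ.<-≤-trans 0<m (ℕ.m≤m+n m m) , (begin
        fold z D (m ℕ.+ m)          ≡⟨ fold-+ z D m ⟩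
        fold (fold z D m) D m       ≡⟨ cong (λ w → fold w D m) D^z≡z̄ ⟩
        fold (conj z) D m           ≡⟨ D^-conj m z ⟩
        conj (fold z D m)           ≡⟨ cong conj D^z≡z̄ ⟩
        conj (conj z)               ≡⟨ conj-involutive z ⟩
        z                           ∎)) ]′
    (π-fibre z∈ (D^-onCircle m z∈) (trans (sym eq) (π∘D^ m z∈)))

  -- The image of f and its two parts

  IsSquare : A → Set a
  IsSquare x = ∃[ b ] b * b ≡ x

  f-image : List A
  f-image = image _≟_ _≟_ f elements

  periodic⇒∈f-image : ∀ {w} → Periodic f w → w ∈ f-image
  periodic⇒∈f-image (suc m , _ , eq) = subst (_∈ f-image) eq (∈-image⁺ _≟_ _≟_ f (∈elements _))

  opposite : A → A
  opposite w = - w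

  ∣f-image∣ : length elements ℕ.+ 1 ≡ 2 ℕ.* length f-image
  ∣f-image∣ = trans (cong (length elements ℕ.+_)
      (sameElements⇒length≡ ([] ∷ []) (Unique.filter⁺ (fixed? _≟_ _≟_ f opposite) elements!) ⊆ ⊇))
    (image-orbits _≟_ _≟_ f opposite elements! (λ {w} _ → ∈elements _ , f∘neg w) (λ _ _ → fibre))
    where
    f∘neg : ∀ w → f (- w) ≡ f w
    f∘neg = solve 1 (λ w → (:- w) :* (:- w) :- (con 1ℤ :+ con 1ℤ) := w :* w :- (con 1ℤ :+ con 1ℤ)) refl
    fibre : ∀ {w w′} → f w ≡ f w′ → w′ ≡ w ⊎ w′ ≡ - w
    fibre {w} {w′} eq = square-roots (f-injective² eq)
      where
      f-injective² : ∀ {w w′} → f w ≡ f w′ → w * w ≡ w′ * w′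
      f-injective² {w} {w′} eq = by-multiple 1# eq
        (solve 2 (λ w w′ → w :* w :- w′ :* w′ := con 1ℤ :*
          ((w :* w :- (con 1ℤ :+ con 1ℤ)) :- (w′ :* w′ :- (con 1ℤ :+ con 1ℤ)))) refl w w′)
    ⊆ : ∀ {w} → w ∈ 0# ∷ [] → w ∈ filter (fixed? _≟_ _≟_ f opposite) elements
    ⊆ (here refl) = ∈-filter⁺ (fixed? _≟_ _≟_ f opposite) (∈elements 0#) -0#≈0#
    ⊇ : ∀ {w} → w ∈ filter (fixed? _≟_ _≟_ f opposite) elements → w ∈ 0# ∷ []
    ⊇ w∈ = here (-x≡x⇒x≡0 (proj₂ (∈-filter⁻ (fixed? _≟_ _≟_ f opposite) {xs = elements} w∈)))

  circle² : List Point
  circle² = imageD circle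

  circle²-isSubgroup : IsSubgroup circle²
  circle²-isSubgroup = imageD-isSubgroup circle-isSubgroup

  -1∈circle : neg one ∈ circle
  -1∈circle = ∈-circle⁺ (trans (norm-neg one) one-onCircle)

  -- The point `(0 , 1)` has order 4 over every field of odd order; hence `D` halves the circle at
  -- least twice.
  -1∈circle² : neg one ∈ circle²
  -1∈circle² = subst (_∈ circle²) D-i (∈-image⁺ _≟ₚ_ _≟ₚ_ D (∈-circle⁺ i∈))
    where
    i∈ : OnCircle (0# , 1#)
    i∈ = solve 0 (con 0ℤ :* con 0ℤ :+ con 1ℤ :* con 1ℤ := con 1ℤ) refl
    D-i : D (0# , 1#) ≡ neg one
    D-i = cong₂ _,_
      (solve 0 (con 0ℤ :* con 0ℤ :- con 1ℤ :* con 1ℤ := :- con 1ℤ) refl)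
      (solve 0 (con 0ℤ :* con 1ℤ :+ con 1ℤ :* con 0ℤ := :- con 0ℤ) refl)

  4∣∣circle∣ : 4 ∣ length circle
  4∣∣circle∣ = divides (length (imageD circle²)) (begin
    length circle                               ≡⟨ ∣imageD∣ circle-isSubgroup -1∈circle ⟩
    2 ℕ.* length circle²                        ≡⟨ cong (2 ℕ.*_) (∣imageD∣ circle²-isSubgroup -1∈circle²) ⟩
    2 ℕ.* (2 ℕ.* length (imageD circle²))       ≡⟨ ℕ.*-assoc 2 2 (length (imageD circle²)) ⟨
    4 ℕ.* length (imageD circle²)               ≡⟨ ℕ.*-comm 4 (length (imageD circle²)) ⟩
    length (imageD circle²) ℕ.* 4               ∎)

  -- The part of f-image on which 2 - w is a square as well.
  split : List A
  split = imageπ circle²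

  split⇒∈f-image : ∀ {w} → w ∈ split → w ∈ f-image
  split⇒∈f-image w∈ with z² , z²∈ , refl ← ∈-image⁻ _≟ₚ_ _≟_ π {circle²} w∈
    with z , z∈ , refl ← ∈-image⁻ _≟ₚ_ _≟ₚ_ D {circle} z²∈
    = subst (_∈ f-image) (f∘π (∈-circle⁻ z∈)) (∈-image⁺ _≟_ _≟_ f (∈elements (π z)))

  -- For `w = 2 (x² - y²)` with `x² + y² = 1` one has `2 - w = (2 y)²`.
  split⇒square : ∀ {w} → w ∈ split → IsSquare (2# - w)
  split⇒square w∈ with z² , z²∈ , refl ← ∈-image⁻ _≟ₚ_ _≟_ π {circle²} w∈
    with (x , y) , z∈ , refl ← ∈-image⁻ _≟ₚ_ _≟ₚ_ D {circle} z²∈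
    = y + y , by-multiple 2# (∈-circle⁻ z∈)
      (solve 2 (λ x y → (y :+ y) :* (y :+ y) :- ((con 1ℤ :+ con 1ℤ) :- ((x :* x :- y :* y) :+ (x :* x :- y :* y)))
        := (con 1ℤ :+ con 1ℤ) :* (x :* x :+ y :* y :- con 1ℤ)) refl x y)

  -- Since `2 - f u = 4 - u²`, a root `b` puts `(u / 2 , b / 2)` on the circle. This point lies over
  -- `u`, so its double lies over `f u`.
  square⇒split : ∀ {u} → IsSquare (2# - f u) → f u ∈ split
  square⇒split {u} (b , bb≡) = subst (_∈ split) (trans (sym (f∘π z∈)) (cong f πz≡u))
    (∈-image⁺ _≟ₚ_ _≟_ π (∈-image⁺ _≟ₚ_ _≟ₚ_ D (∈-circle⁺ z∈)))
    where
    z : Point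
    z = (½ * u) , (½ * b)
    z∈ : OnCircle z
    z∈ = by-combination (½ * ½) ((2# * ½) + 1#) bb≡ 2½≡1
      (solve 3 (λ h u b → (h :* u) :* (h :* u) :+ (h :* b) :* (h :* b) :- con 1ℤ
        := (h :* h) :* (b :* b :- ((con 1ℤ :+ con 1ℤ) :- (u :* u :- (con 1ℤ :+ con 1ℤ))))
          :+ ((con 1ℤ :+ con 1ℤ) :* h :+ con 1ℤ) :* ((con 1ℤ :+ con 1ℤ) :* h :- con 1ℤ)) refl ½ u b)
    πz≡u : π z ≡ u
    πz≡u = by-multiple u 2½≡1
      (solve 2 (λ h u → h :* u :+ h :* u :- u := u :* ((con 1ℤ :+ con 1ℤ) :* h :- con 1ℤ)) refl ½ u)

  ∈f-image⇒square : ∀ {w} → w ∈ f-image → IsSquare (2# + w)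
  ∈f-image⇒square w∈ with u , _ , refl ← ∈-image⁻ _≟_ _≟_ f {elements} w∈ =
    u , solve 1 (λ u → u :* u := (con 1ℤ :+ con 1ℤ) :+ (u :* u :- (con 1ℤ :+ con 1ℤ))) refl u

  open DecMembership _≟_ using (_∈?_)

  -- These are the `w` in the image with `2 - w` not a square. Membership in the list `split` is
  -- used instead because it is decidable at once.
  nonsplit : List A
  nonsplit = filter (λ w → ¬? (w ∈? split)) f-image

  ∈-nonsplit⁺ : ∀ {w} → w ∈ f-image → ¬ IsSquare (2# - w) → w ∈ nonsplit
  ∈-nonsplit⁺ w∈ ¬□ = ∈-filter⁺ (λ w → ¬? (w ∈? split)) w∈ (¬□ ∘ split⇒square)

  nonsplit⇒∈f-image : ∀ {w} → w ∈ nonsplit → w ∈ f-image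
  nonsplit⇒∈f-image = proj₁ ∘ ∈-filter⁻ (λ w → ¬? (w ∈? split)) {xs = f-image}

  nonsplit⇒∉split : ∀ {w} → w ∈ nonsplit → w ∉ split
  nonsplit⇒∉split = proj₂ ∘ ∈-filter⁻ (λ w → ¬? (w ∈? split)) {xs = f-image}

  nonsplit⇒nonsquare : ∀ {w} → w ∈ nonsplit → ¬ IsSquare (2# - w)
  nonsplit⇒nonsquare w∈ □ with u , _ , refl ← ∈-image⁻ _≟_ _≟_ f {elements} (nonsplit⇒∈f-image w∈) =
    nonsplit⇒∉split w∈ (square⇒split □)

  square-quotient : ∀ {u b x} → u ≢ 0# → b * b ≡ (u * u) * x → IsSquare x
  square-quotient {u} {b} {x} u≢0 bb≡ = b * v , by-combination (v * v) (((u * v) + 1#) * x) bb≡ uv≡1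
    (solve 4 (λ u b x v → (b :* v) :* (b :* v) :- x := (v :* v) :* (b :* b :- (u :* u) :* x)
      :+ ((u :* v :+ con 1ℤ) :* x) :* (u :* v :- con 1ℤ)) refl u b x v)
    where
    v = proj₁ (inverse u u≢0)
    uv≡1 = proj₂ (inverse u u≢0)

  -- With 2 + w = u², one has 2 - f w = (2 - w) u².
  nonsquare-f : ∀ {w} → IsSquare (2# + w) → ¬ IsSquare (2# - w) → ¬ IsSquare (2# - f w)
  nonsquare-f {w} (u , uu≡) ¬□ (b , bb≡) = ¬□ (by-cases (u ≟ 0#))
    where
    by-cases : Dec (u ≡ 0#) → IsSquare (2# - w)
    -- Here `w = - 2`, so `2 - w` is the square of 2.
    by-cases (yes u≡0) = 2# , by-combination u (- 1#) u≡0 uu≡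
      (solve 2 (λ u w → (con 1ℤ :+ con 1ℤ) :* (con 1ℤ :+ con 1ℤ) :- ((con 1ℤ :+ con 1ℤ) :- w)
        := u :* (u :- con 0ℤ) :+ (:- con 1ℤ) :* (u :* u :- ((con 1ℤ :+ con 1ℤ) :+ w))) refl u w)
    by-cases (no u≢0) = square-quotient u≢0 (by-combination 1# (w - 2#) bb≡ uu≡
      (solve 3 (λ u w b → b :* b :- (u :* u) :* ((con 1ℤ :+ con 1ℤ) :- w)
        := con 1ℤ :* (b :* b :- ((con 1ℤ :+ con 1ℤ) :- (w :* w :- (con 1ℤ :+ con 1ℤ))))
          :+ (w :- (con 1ℤ :+ con 1ℤ)) :* (u :* u :- ((con 1ℤ :+ con 1ℤ) :+ w))) refl u w b))

  nonsplit-closed : ∀ {w} → w ∈ nonsplit → f w ∈ nonsplit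
  nonsplit-closed {w} w∈ = ∈-nonsplit⁺ (∈-image⁺ _≟_ _≟_ f (∈elements w))
    (nonsquare-f (∈f-image⇒square (nonsplit⇒∈f-image w∈)) (nonsplit⇒nonsquare w∈))

  -- The other preimage `- w` is excluded: `2 + (- w)` would have to be a square, but it is `2 - w`.
  nonsplit-injective : ∀ {w w′} → w ∈ nonsplit → w′ ∈ nonsplit → f w ≡ f w′ → w ≡ w′
  nonsplit-injective {w} {w′} w∈ w′∈ eq =
    [ sym , (λ w′≡-w → contradiction
        (subst IsSquare (cong (λ x → 2# + x) w′≡-w) (∈f-image⇒square (nonsplit⇒∈f-image w′∈)))
        (nonsplit⇒nonsquare w∈)) ]′
    (square-roots (by-multiple 1# eq
      (solve 2 (λ w w′ → w :* w :- w′ :* w′ := con 1ℤ :*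
        ((w :* w :- (con 1ℤ :+ con 1ℤ)) :- (w′ :* w′ :- (con 1ℤ :+ con 1ℤ)))) refl w w′)))

  nonsplit-periodic : ∀ {w} → w ∈ nonsplit → Periodic f w
  nonsplit-periodic = injective⇒periodic f nonsplit nonsplit-closed nonsplit-injective

  -- Counting the periodic values

  oddCircle : List Point
  oddCircle = OddPart.H oddPart

  oddCircle-isSubgroup : IsSubgroup oddCircle
  oddCircle-isSubgroup = OddPart.isSubgroup oddPart

  -1∉oddCircle : neg one ∉ oddCircle
  -1∉oddCircle = OddPart.-1∉ oddPart

  -- Distinct points with the same double have quotient `neg one`, which this subgroup lacks; so `D`
  -- permutes it.
  oddCircle-periodic : ∀ {z} → z ∈ oddCircle → Periodic D z
  oddCircle-periodic = injective⇒periodic D oddCircle (λ z∈ → ·-closed S z∈ z∈) (λ {z} {w} z∈ w∈ eq →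
    [ sym , (λ (_ , q≡-1) → contradiction
        (subst (_∈ oddCircle) q≡-1 (·-closed S w∈ (conj-closed S z∈))) -1∉oddCircle) ]′
    (D-fibre (onCircle S z∈) (onCircle S w∈) eq))
    where S = oddCircle-isSubgroup

  periodic⇒∈circle² : ∀ {z} → OnCircle z → Periodic D z → z ∈ circle²
  periodic⇒∈circle² z∈ (suc m , _ , eq) = subst (_∈ circle²) eq
    (∈-image⁺ _≟ₚ_ _≟ₚ_ D (∈-circle⁺ (D^-onCircle m z∈)))

  -- `conj` pairs off all points but `one`.
  ∣oddCircle∣-odd : Oddℕ (length oddCircle)
  ∣oddCircle∣-odd = half (length (imageπ oddCircle))
    (trans (ℕ.+-comm 1 (length oddCircle)) (∣imageπ∣-odd oddCircle-isSubgroup -1∉oddCircle))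
    where
    half : ∀ k {n} → 1 ℕ.+ n ≡ 2 ℕ.* k → Oddℕ n
    half (suc k) eq = k , ℕ.suc-injective (trans eq (ℕ.*-suc 2 k))

  module _ {ps : List A} (ps! : Unique ps) (∈ps⇒periodic : ∀ {w} → w ∈ ps → Periodic f w)
           (periodic⇒∈ps : ∀ {w} → Periodic f w → w ∈ ps) where

    ∣periodic∣-split : length ps ≡ length nonsplit ℕ.+ length (imageπ oddCircle)
    ∣periodic∣-split = length-disjoint (Unique.filter⁺ (λ w → ¬? (w ∈? split)) (image-unique _≟_ _≟_ f elements))
      (image-unique _≟ₚ_ _≟_ π oddCircle) ps!
      (λ w∈ w∈π → nonsplit⇒∉split w∈ (π-odd⇒split w∈π))
      (λ w∈ → by-type (∈ps⇒periodic w∈))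
      (λ w∈ → periodic⇒∈ps (nonsplit-periodic w∈))
      (λ w∈ → periodic⇒∈ps (π-odd-periodic w∈))
      where
      π-odd⇒split : ∀ {w} → w ∈ imageπ oddCircle → w ∈ split
      π-odd⇒split w∈ with z , z∈ , refl ← ∈-image⁻ _≟ₚ_ _≟_ π {oddCircle} w∈ =
        ∈-image⁺ _≟ₚ_ _≟_ π (periodic⇒∈circle² (onCircle oddCircle-isSubgroup z∈) (oddCircle-periodic z∈))
      π-odd-periodic : ∀ {w} → w ∈ imageπ oddCircle → Periodic f w
      π-odd-periodic w∈ with z , z∈ , refl ← ∈-image⁻ _≟ₚ_ _≟_ π {oddCircle} w∈ =
        π-periodic⁺ (onCircle oddCircle-isSubgroup z∈) (oddCircle-periodic z∈)
      split-periodic : ∀ {w} → w ∈ split → Periodic f w → w ∈ imageπ oddCircle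
      split-periodic w∈ p with z , z∈ , refl ← ∈-image⁻ _≟ₚ_ _≟_ π {circle²} w∈ =
        ∈-image⁺ _≟ₚ_ _≟_ π (OddPart.periodic⇒∈ oddPart z∈′ (π-periodic⁻ z∈′ p))
        where z∈′ = onCircle circle²-isSubgroup z∈
      by-type : ∀ {w} → Periodic f w → w ∈ nonsplit ⊎ w ∈ imageπ oddCircle
      by-type {w} p with w ∈? split
      ... | yes w∈ = inj₂ (split-periodic w∈ p)
      ... | no  w∉ = inj₁ (∈-filter⁺ (λ w → ¬? (w ∈? split)) (periodic⇒∈f-image p) w∉)

    ∣f-image∣-split : length f-image ≡ length nonsplit ℕ.+ length split
    ∣f-image∣-split = length-disjoint (Unique.filter⁺ (λ w → ¬? (w ∈? split)) (image-unique _≟_ _≟_ f elements))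
      (image-unique _≟ₚ_ _≟_ π circle²) (image-unique _≟_ _≟_ f elements)
      nonsplit⇒∉split by-type nonsplit⇒∈f-image split⇒∈f-image
      where
      by-type : ∀ {w} → w ∈ f-image → w ∈ nonsplit ⊎ w ∈ split
      by-type {w} w∈f with w ∈? split
      ... | yes w∈ = inj₂ w∈
      ... | no  w∉ = inj₁ (∈-filter⁺ (λ w → ¬? (w ∈? split)) w∈f w∉)

    -- With `q`, `N`, `m` the sizes of the field, the circle and its odd part, the image of `f` has
    -- `(q + 1) / 2` elements, `split` has `(N / 2 + 2) / 2` and the periodic part of `split` has
    -- `(m + 1) / 2`. The count is the first minus the second plus the third, cleared of
    -- denominators and subtraction.
    ∣periodic∣ : 4 ℕ.* length ps ℕ.+ length circle ≡ 2 ℕ.* length elements ℕ.+ 2 ℕ.* length oddCircle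
    ∣periodic∣ = arithmetic {b = length nonsplit} {length (imageπ oddCircle)} {c = length split} {length circle²}
      ∣periodic∣-split ∣f-image∣ ∣f-image∣-split
      (∣imageD∣ circle-isSubgroup -1∈circle) (∣imageπ∣-even circle²-isSubgroup -1∈circle²)
      (∣imageπ∣-odd oddCircle-isSubgroup -1∉oddCircle)
      where
      open +-*-Solver using () renaming (solve to solveℕ; _:=_ to _⊜_; _:+_ to _⊕_; _:*_ to _⊗_; con to κ)
      arithmetic : ∀ {P N q m b a s c d} → P ≡ b ℕ.+ a → q ℕ.+ 1 ≡ 2 ℕ.* s → s ≡ b ℕ.+ c →
        N ≡ 2 ℕ.* d → d ℕ.+ 2 ≡ 2 ℕ.* c → m ℕ.+ 1 ≡ 2 ℕ.* a →
        4 ℕ.* P ℕ.+ N ≡ 2 ℕ.* q ℕ.+ 2 ℕ.* m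
      -- The extra 4 completes `2 d` to `2 (d + 2)`; it reappears at the end from
      -- `2 (q + 1) + 2 (m + 1)`.
      arithmetic {q = q} {m} {b} {a} {c = c} {d} refl q+1 refl refl d+2 m+1 = ℕ.+-cancelʳ-≡ 4 _ _ (begin
        4 ℕ.* (b ℕ.+ a) ℕ.+ 2 ℕ.* d ℕ.+ 4
          ≡⟨ solveℕ 3 (λ a b d → κ 4 ⊗ (b ⊕ a) ⊕ κ 2 ⊗ d ⊕ κ 4 ⊜ κ 4 ⊗ b ⊕ κ 2 ⊗ (d ⊕ κ 2) ⊕ κ 2 ⊗ (κ 2 ⊗ a)) refl a b d ⟩
        4 ℕ.* b ℕ.+ 2 ℕ.* (d ℕ.+ 2) ℕ.+ 2 ℕ.* (2 ℕ.* a)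
          ≡⟨ cong₂ (λ x y → 4 ℕ.* b ℕ.+ 2 ℕ.* x ℕ.+ 2 ℕ.* y) d+2 (sym m+1) ⟩
        4 ℕ.* b ℕ.+ 2 ℕ.* (2 ℕ.* c) ℕ.+ 2 ℕ.* (m ℕ.+ 1)
          ≡⟨ solveℕ 3 (λ b c m → κ 4 ⊗ b ⊕ κ 2 ⊗ (κ 2 ⊗ c) ⊕ κ 2 ⊗ (m ⊕ κ 1) ⊜ κ 2 ⊗ (κ 2 ⊗ (b ⊕ c)) ⊕ κ 2 ⊗ (m ⊕ κ 1)) refl b c m ⟩
        2 ℕ.* (2 ℕ.* (b ℕ.+ c)) ℕ.+ 2 ℕ.* (m ℕ.+ 1)
          ≡⟨ cong (λ x → 2 ℕ.* x ℕ.+ 2 ℕ.* (m ℕ.+ 1)) q+1 ⟨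
        2 ℕ.* (q ℕ.+ 1) ℕ.+ 2 ℕ.* (m ℕ.+ 1)
          ≡⟨ solveℕ 2 (λ q m → κ 2 ⊗ (q ⊕ κ 1) ⊕ κ 2 ⊗ (m ⊕ κ 1) ⊜ κ 2 ⊗ q ⊕ κ 2 ⊗ m ⊕ κ 4) refl q m ⟩
        2 ℕ.* q ℕ.+ 2 ℕ.* m ℕ.+ 4 ∎)

open import Data.Nat.Base using (_+_; _*_; _∸_; _^_; _⊔_)

-- Transport of the count to a given finite field

module _ {c ℓ₁ ℓ₂ q} (K : FiniteField c ℓ₁ ℓ₂ q) (¬2∣q : ¬ 2 ∣ q) where
  private
    open FiniteField K
      using (_≈_; enumeration; index; element; element-index; index-injective; heytingField;
             tight; #⇒invertible; invertible⇒#; #-irrefl)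
    module K = CommutativeRing (FiniteField.commutativeRing K)
    open Inverse enumeration using () renaming (from-cong to element-cong; strictlyInverseˡ to index-element)
    open RingProperties K.ring using (-0#≈0#)
    open Evaluation (FiniteField.commutativeRing K)

    -- Carrying the operations over to `Fin q` turns the setoid equality of the field into `_≡_`, as
    -- the lists without repetitions require.
    elementRing : RawRing 0ℓ 0ℓ
    elementRing = record
      { Carrier = Fin q
      ; _≈_     = _≡_
      ; _+_     = λ i j → index (element i K.+ element j)
      ; _*_     = λ i j → index (element i K.* element j)
      ; -_      = λ i → index (K.- element i)
      ; 0#      = index K.0#
      ; 1#      = index K.1#
      }

    module E = RawRing elementRing

    element-≈ : ∀ x → element (index x) ≈ x
    element-≈ _ = element-index refl

    element-injective : ∀ {i j} → element i ≈ element j → i ≡ j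
    element-injective eq = trans (sym (index-element _))
      (trans (Inverse.to-cong enumeration eq) (index-element _))

    element-isRingMonomorphism : IsRingMonomorphism elementRing K.rawRing element
    element-isRingMonomorphism = record
      { isRingHomomorphism = record
        { isSemiringHomomorphism = record
          { isNearSemiringHomomorphism = record
            { +-isMonoidHomomorphism = record
              { isMagmaHomomorphism = record
                { isRelHomomorphism = record { cong = element-cong }
                ; homo = λ i j → element-≈ _ }
              ; ε-homo = element-≈ _ }
            ; *-homo = λ i j → element-≈ _ }
          ; 1#-homo = element-≈ _ }
        ; -‿homo = λ i → element-≈ _ }
      ; injective = element-injective }

    1≢0 : E.1# ≢ E.0#
    1≢0 eq = #-irrefl 1≈0 (invertible⇒# (K.1# , inverse , K.trans (K.*-comm _ _) inverse))
      where
      1≈0 : K.1# ≈ K.0#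
      1≈0 = index-injective eq
      inverse : K.1# K.* (K.1# K.- K.0#) ≈ K.1#
      inverse = K.trans (K.*-identityˡ _) (K.trans (K.+-congˡ -0#≈0#) (K.+-identityʳ _))

    -- A Heyting field inverts only what is apart from 0. A search through `Fin q` decides
    -- invertibility; if it fails, the element is not apart from 0, so tightness makes it equal to
    -- 0.
    inverse : ∀ i → i ≢ E.0# → ∃[ j ] i E.* j ≡ E.1#
    inverse i i≢0 with Fin.any? (λ j → (i E.* j) Fin.≟ E.1#)
    ... | yes invertible = invertible
    ... | no ¬invertible = contradiction
      (element-injective (K.trans (proj₁ (tight (element i) K.0#) λ i#0 →
        let y , _ , xy≈1 = #⇒invertible i#0 in
        ¬invertible (index y , Inverse.to-cong enumeration (K.trans
          (K.*-cong (K.sym (K.trans (K.+-congˡ -0#≈0#) (K.+-identityʳ _))) (element-≈ y)) xy≈1)))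
        (K.sym (element-≈ K.0#))))
      i≢0

    ∣allFin∣ : length (allFin q) ≡ q
    ∣allFin∣ = length-tabulate id

    module Squaring = OddFiniteField {A = Fin q} {E._+_} {E._*_} {E.-_} {E.0#} {E.1#}
      (RingMonomorphism.isCommutativeRing element-isRingMonomorphism K.isCommutativeRing)
      1≢0 inverse Fin._≟_ (allFin q) (Unique.allFin⁺ q) ∈-allFin
      (λ d → ¬2∣q (subst (2 ∣_) ∣allFin∣ d))

    T₂-value : ∀ x → ⟦ T 2 ⟧ x ≈ x K.* x K.- (K.1# K.+ K.1#)
    -- The left side copies the Horner form of the coefficients - 2, 0, 1, including the trailing
    -- zeros produced by `fromℤ` and by the empty list.
    T₂-value = solve 1 (λ x → (:- (con 1ℤ :+ (con 1ℤ :+ con 0ℤ)))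
        :+ x :* (con 0ℤ :+ x :* ((con 1ℤ :+ con 0ℤ) :+ x :* con 0ℤ))
      := x :* x :- (con 1ℤ :+ con 1ℤ)) refl
      where open IntegerSolver (FiniteField.commutativeRing K)

    element-f : ∀ i → ⟦ T 2 ⟧ (element i) ≈ element (Squaring.f i)
    element-f i = K.trans (T₂-value (element i)) (K.sym (K.trans (element-≈ _)
      (K.+-cong (element-≈ _) (K.trans (element-≈ _) (K.-‿cong
        (K.trans (element-≈ _) (K.+-cong (element-≈ _) (element-≈ _))))))))

    element-f^ : ∀ m i → fold (element i) ⟦ T 2 ⟧ m ≈ element (fold i Squaring.f m)
    element-f^ zero    i = K.refl
    element-f^ (suc m) i = K.trans (⟦ T 2 ⟧-cong (element-f^ m i)) (element-f _)

    Per⇒periodic : ∀ {i} → Per heytingField (T 2) (element i) → Periodic Squaring.f i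
    Per⇒periodic {i} (m , 0<m , eq) = m , 0<m , element-injective (K.trans (K.sym (element-f^ m i)) eq)

    periodic⇒Per : ∀ {i} → Periodic Squaring.f i → Per heytingField (T 2) (element i)
    periodic⇒Per {i} (m , 0<m , eq) = m , 0<m , K.trans (element-f^ m i) (element-cong eq)

    Per-T₂? : ∀ i → Dec (Per heytingField (T 2) (element i))
    Per-T₂? i = Per? K (T 2) (element i)

  abstract
    #Per-T₂ : ∃[ N ] ∃[ s ] ∃[ m ] (N ≡ 1 + q ⊎ 1 + N ≡ q) × 4 ∣ N × N ≡ 2 ^ s * m × Oddℕ m ×
      4 * #Per (T 2) K + N ≡ 2 * q + 2 * m
    #Per-T₂ = length circle , OddPart.s oddPart , length oddCircle ,
      Sum.map (λ eq → trans eq (cong suc ∣allFin∣)) (λ eq → trans eq ∣allFin∣) ∣circle∣ ,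
      4∣∣circle∣ , OddPart.order oddPart , ∣oddCircle∣-odd ,
      trans (∣periodic∣ (Unique.filter⁺ Per-T₂? (Unique.allFin⁺ q))
          (λ i∈ → Per⇒periodic (proj₂ (∈-filter⁻ Per-T₂? {xs = allFin q} i∈)))
          (λ per → ∈-filter⁺ Per-T₂? (∈-allFin _) (periodic⇒Per per)))
        (cong (λ n → 2 * n + 2 * length oddCircle) ∣allFin∣)
      where open Squaring

-- The limit

private
  ∣difference∣≤ : ∀ {A B x y} → A ℕ.+ x ≡ B ℕ.+ y → ℤ.∣ + A ℤ.- + B ∣ ≤ y ℕ.+ x
  ∣difference∣≤ {A} {B} {x} {y} eq = subst (λ i → ℤ.∣ i ∣ ≤ y ℕ.+ x) (sym shift) (ℤ.∣i-j∣≤∣i∣+∣j∣ (+ y) (+ x))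
    where
    open ℤ-Solver
    open ≡-Reasoning
    shift : + A ℤ.- + B ≡ + y ℤ.- + x
    shift = begin
      + A ℤ.- + B                       ≡⟨ solve 3 (λ a b x → a :- b := (a :+ x) :- b :- x) refl (+ A) (+ B) (+ x) ⟩
      (+ A ℤ.+ + x) ℤ.- + B ℤ.- + x     ≡⟨ cong (λ n → + n ℤ.- + B ℤ.- + x) eq ⟩
      (+ B ℤ.+ + y) ℤ.- + B ℤ.- + x     ≡⟨ solve 3 (λ b y x → (b :+ y) :- b :- x := y :- x) refl (+ B) (+ y) (+ x) ⟩
      + y ℤ.- + x                       ∎

-- Cross multiplication, carried out on unnormalised fractions: there the difference has denominator
-- `q r` with no common factor removed.
∣fraction-difference∣< : ∀ i j q r .{{_ : NonZero q}} .{{_ : NonZero r}} ε e → ℚ.↥ ε ≡ + e →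
  ℤ.∣ i ℤ.* + r ℤ.- j ℤ.* + q ∣ ℕ.* ↧ₙ ε < e ℕ.* (q ℕ.* r) →
  ℚ.∣ i ℚ./ q ℚ.- j ℚ./ r ∣ ℚ.< ε
∣fraction-difference∣< i j q@(suc q′) r@(suc r′) ε@(mkℚ _ d _) e refl bound =
  ℚ.toℚᵘ-cancel-< (ℚᵘ.<-respˡ-≃ (ℚᵘ.≃-sym unnormalise) (ℚᵘ.*<* (ℤ.≤-<-trans (ℤ.≤-reflexive numerator)
    (subst (+ (ℤ.∣ i ℤ.* + r ℤ.- j ℤ.* + q ∣ ℕ.* suc d) ℤ.<_) (ℤ.pos-* e (q ℕ.* r)) (ℤ.+<+ bound)))))
  where
  x y : ℚ
  x = i ℚ./ q
  y = j ℚ./ r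
  unnormalise : toℚᵘ ℚ.∣ x ℚ.- y ∣ ≃ ℚᵘ.∣ mkℚᵘ i q′ ℚᵘ.- mkℚᵘ j r′ ∣
  unnormalise = begin
    toℚᵘ ℚ.∣ x ℚ.- y ∣              ≈⟨ ℚ.toℚᵘ-homo-∣-∣ (x ℚ.- y) ⟩
    ℚᵘ.∣ toℚᵘ (x ℚ.- y) ∣           ≈⟨ ℚᵘ.∣-∣-cong (ℚ.toℚᵘ-homo-+ x (ℚ.- y)) ⟩
    ℚᵘ.∣ toℚᵘ x ℚᵘ.+ toℚᵘ (ℚ.- y) ∣ ≈⟨ ℚᵘ.∣-∣-cong (ℚᵘ.+-cong (ℚ.toℚᵘ-fromℚᵘ (mkℚᵘ i q′))
                                          (ℚᵘ.≃-trans (ℚ.toℚᵘ-homo‿- y) (ℚᵘ.-‿cong (ℚ.toℚᵘ-fromℚᵘ (mkℚᵘ j r′))))) ⟩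
    ℚᵘ.∣ mkℚᵘ i q′ ℚᵘ.- mkℚᵘ j r′ ∣ ∎
    where open ≈-Reasoning ℚᵘ.≃-setoid
  numerator : + ℤ.∣ i ℤ.* + r ℤ.+ (ℤ.- j) ℤ.* + q ∣ ℤ.* + suc d ≡ + (ℤ.∣ i ℤ.* + r ℤ.- j ℤ.* + q ∣ ℕ.* suc d)
  numerator = trans (sym (ℤ.pos-* ℤ.∣ i ℤ.* + r ℤ.+ (ℤ.- j) ℤ.* + q ∣ (suc d)))
    (cong (λ k → + (ℤ.∣ i ℤ.* + r ℤ.+ k ∣ ℕ.* suc d)) (sym (ℤ.neg-distribˡ-* j (+ q))))

-- With c = 2 ^ (M - 1), the hypotheses give 4 c P - (c + 1) q = ± (c - 1).
density-estimate : ∀ M k {P q N m} .{{_ : NonZero q}} .{{_ : NonZero (2 ℕ.^ (M ℕ.+ 1))}} → M ≡ 2 ℕ.+ k →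
  N ≡ 1 ℕ.+ q ⊎ 1 ℕ.+ N ≡ q → N ≡ 2 ℕ.^ M ℕ.* m → 4 ℕ.* P ℕ.+ N ≡ 2 ℕ.* q ℕ.+ 2 ℕ.* m →
  ∀ ε → 0ℚ ℚ.< ε → ↧ₙ ε ≤ q →
  ℚ.∣ (+ P) ℚ./ q ℚ.- (+ (2 ℕ.^ (M ℕ.∸ 1) ℕ.+ 1)) ℚ./ (2 ℕ.^ (M ℕ.+ 1)) ∣ ℚ.< ε
density-estimate M k {P} {q} {N} {m} refl N±1 N≡ count ε@(mkℚ (+ suc e) d _) 0<ε d≤q =
  ∣fraction-difference∣< (+ P) (+ (c ℕ.+ 1)) q r ε (suc e) refl (begin-strict
    ℤ.∣ (+ P) ℤ.* + r ℤ.- (+ (c ℕ.+ 1)) ℤ.* + q ∣ ℕ.* suc d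
      ≡⟨ cong₂ (λ i j → ℤ.∣ i ℤ.- j ∣ ℕ.* suc d) (ℤ.pos-* P r) (ℤ.pos-* (c ℕ.+ 1) q) ⟨
    ℤ.∣ + (P ℕ.* r) ℤ.- + ((c ℕ.+ 1) ℕ.* q) ∣ ℕ.* suc d   ≤⟨ ℕ.*-mono-≤ (numerator≤ N±1) d≤q ⟩
    -- The denominator `r = 4 c` exceeds the bound `2 c` on the numerator by a factor of 2, which
    -- makes the estimate strict.
    (c ℕ.+ c) ℕ.* q                                       <⟨ ℕ.m<m+n _ (ℕ.*-mono-≤ 0<2c 0<q) ⟩
    (c ℕ.+ c) ℕ.* q ℕ.+ (c ℕ.+ c) ℕ.* q                   ≡⟨ solve 2 (λ c q → (c :+ c) :* q :+ (c :+ c) :* q := q :* (con 4 :* c)) refl c q ⟩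
    q ℕ.* (4 ℕ.* c)                                       ≡⟨ cong (q ℕ.*_) r≡4c ⟨
    q ℕ.* r                                               ≤⟨ ℕ.m≤n*m (q ℕ.* r) (suc e) ⟩
    suc e ℕ.* (q ℕ.* r)                                   ∎)
  where
  open ℕ.≤-Reasoning
  open +-*-Solver
  c r : ℕ
  c = 2 ℕ.^ (1 ℕ.+ k)
  r = 2 ℕ.^ (2 ℕ.+ k ℕ.+ 1)
  r≡4c : r ≡ 4 ℕ.* c
  r≡4c = trans (cong (λ n → 2 ℕ.* (2 ℕ.* (2 ℕ.^ n))) (ℕ.+-comm k 1)) (sym (ℕ.*-assoc 2 2 c))
  0<c : 0 < c
  0<c = ℕ.m^n>0 2 (1 ℕ.+ k)
  0<2c : 0 < c ℕ.+ c
  0<2c = ℕ.≤-trans 0<c (ℕ.m≤m+n c c)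
  0<q : 0 < q
  0<q = ℕ.≤-trans (s≤s z≤n) d≤q
  -- The count multiplied by `c`; since `2 c = 2 ^ M`, the term `2 c m` becomes `N`.
  scaled : P ℕ.* r ℕ.+ c ℕ.* N ≡ 2 ℕ.* c ℕ.* q ℕ.+ N
  scaled = begin-equality
    P ℕ.* r ℕ.+ c ℕ.* N                    ≡⟨ cong (λ r → P ℕ.* r ℕ.+ c ℕ.* N) r≡4c ⟩
    P ℕ.* (4 ℕ.* c) ℕ.+ c ℕ.* N            ≡⟨ solve 3 (λ P c N → P :* (con 4 :* c) :+ c :* N := c :* (con 4 :* P :+ N)) refl P c N ⟩
    c ℕ.* (4 ℕ.* P ℕ.+ N)                  ≡⟨ cong (c ℕ.*_) count ⟩
    c ℕ.* (2 ℕ.* q ℕ.+ 2 ℕ.* m)            ≡⟨ solve 3 (λ c q m → c :* (con 2 :* q :+ con 2 :* m) := con 2 :* c :* q :+ con 2 :* c :* m) refl c q m ⟩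
    2 ℕ.* c ℕ.* q ℕ.+ 2 ℕ.* c ℕ.* m        ≡⟨ cong (2 ℕ.* c ℕ.* q ℕ.+_) N≡ ⟨
    2 ℕ.* c ℕ.* q ℕ.+ N                    ∎
  numerator≤ : N ≡ 1 ℕ.+ q ⊎ 1 ℕ.+ N ≡ q → ℤ.∣ + (P ℕ.* r) ℤ.- + ((c ℕ.+ 1) ℕ.* q) ∣ ≤ c ℕ.+ c
  numerator≤ (inj₁ refl) = ℕ.≤-trans (∣difference∣≤ {P ℕ.* r} {(c ℕ.+ 1) ℕ.* q} {c} {1} (ℕ.+-cancelʳ-≡ (c ℕ.* q) _ _ (begin-equality
    P ℕ.* r ℕ.+ c ℕ.+ c ℕ.* q              ≡⟨ solve 3 (λ p c q → p :+ c :+ c :* q := p :+ c :* (con 1 :+ q)) refl (P ℕ.* r) c q ⟩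
    P ℕ.* r ℕ.+ c ℕ.* (1 ℕ.+ q)            ≡⟨ scaled ⟩
    2 ℕ.* c ℕ.* q ℕ.+ (1 ℕ.+ q)            ≡⟨ solve 2 (λ c q → con 2 :* c :* q :+ (con 1 :+ q) := (c :+ con 1) :* q :+ con 1 :+ c :* q) refl c q ⟩
    (c ℕ.+ 1) ℕ.* q ℕ.+ 1 ℕ.+ c ℕ.* q      ∎))) (ℕ.+-monoˡ-≤ c 0<c)
  numerator≤ (inj₂ refl) = ℕ.≤-trans (∣difference∣≤ {P ℕ.* r} {(c ℕ.+ 1) ℕ.* (1 ℕ.+ N)} {1} {c} (ℕ.+-cancelʳ-≡ (c ℕ.* N) _ _ (begin-equality
    P ℕ.* r ℕ.+ 1 ℕ.+ c ℕ.* N              ≡⟨ solve 2 (λ p n → p :+ con 1 :+ n := p :+ n :+ con 1) refl (P ℕ.* r) (c ℕ.* N) ⟩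
    P ℕ.* r ℕ.+ c ℕ.* N ℕ.+ 1              ≡⟨ cong (ℕ._+ 1) scaled ⟩
    2 ℕ.* c ℕ.* (1 ℕ.+ N) ℕ.+ N ℕ.+ 1      ≡⟨ solve 2 (λ c n → con 2 :* c :* (con 1 :+ n) :+ n :+ con 1 := (c :+ con 1) :* (con 1 :+ n) :+ c :+ c :* n) refl c N ⟩
    (c ℕ.+ 1) ℕ.* (1 ℕ.+ N) ℕ.+ c ℕ.+ c ℕ.* N ∎))) (ℕ.+-monoʳ-≤ c 0<c)
density-estimate M k refl _ _ _ (mkℚ (+ zero) _ _) (ℚ.*<* (ℤ.+<+ ())) _
density-estimate M k refl _ _ _ (mkℚ -[1+ _ ] _ _) (ℚ.*<* ()) _

nearSign-prime : ∀ {p} → Prime p → ¬ 2 ∣ p →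
  let μ = v₂ (p ∸ 1) ⊔ v₂ (p + 1) in ∃[ j ] μ ≡ 2 + j × NearSign (2 + j) (+ p)
nearSign-prime {p} p-prime ¬2∣p = from-odd (¬2∣⇒odd ¬2∣p)
  where
  from-odd : Oddℕ p → let μ = v₂ (p ∸ 1) ⊔ v₂ (p + 1) in ∃[ j ] μ ≡ 2 + j × NearSign (2 + j) (+ p)
  from-odd (zero  , refl) = contradiction p-prime ¬prime[1]
  from-odd (suc t , refl) =
    let near-p , 2≤μ = nearSign-base t
        j , 2+j≡μ    = ℕ.m≤n⇒∃[o]m+o≡n 2≤μ
    in j , trans (cong (λ n → v₂ (2 * suc t) ⊔ v₂ n) (ℕ.+-comm (1 + 2 * suc t) 1)) (sym 2+j≡μ)
         , subst (λ M → NearSign M (+ p)) (sym 2+j≡μ) near-p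

nearSign⇒odd : ∀ j {n} → NearSign (2 + j) (+ n) → ¬ 2 ∣ n
nearSign⇒odd j {n} (near {ε} {v} sgn _ eq) (divides k n≡k*2) =
  odd≢even (+ k) (odd-+-even ((+ 2) ℤ.^ (1 + j) ℤ.* v) (odd-sign sgn)) (begin
    ε ℤ.+ + 2 ℤ.* ((+ 2) ℤ.^ (1 + j) ℤ.* v)   ≡⟨ cong (λ i → ε ℤ.+ i) (ℤ.*-assoc (+ 2) ((+ 2) ℤ.^ (1 + j)) v) ⟨
    ε ℤ.+ (+ 2) ℤ.^ (2 + j) ℤ.* v             ≡⟨ eq ⟨
    + n                                       ≡⟨ cong +_ (trans n≡k*2 (ℕ.*-comm k 2)) ⟩
    + (2 * k)                                 ≡⟨ ℤ.pos-* 2 k ⟩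
    + 2 ℤ.* + k                               ∎)
  where
  open ≡-Reasoning

theorem5p6 : ∀ {c ℓ₁ ℓ₂} (p : ℕ) (p-prime : Prime p) → ¬ (2 ∣ p) →
    (𝔽 : ∀ n → .{{NonZero n}} → FiniteField c ℓ₁ ℓ₂ (p ^ n)) →
    (ν : ℕ) →
    let μ = v₂ (p ∸ 1) ⊔ v₂ (p + 1) in
    LimitAlong
    (λ n → v₂ n ≡ ν)
    (λ n → _/_ (+ (#Per (T 2) (𝔽 n))) (p ^ n) {{m^n≢0 p n {{prime⇒nonZero p-prime}}}})
    (_/_ (+ (2 ^ (μ + ν ∸ 1) + 1)) (2 ^ (μ + ν + 1)) {{m^n≢0 2 (μ + ν + 1)}})
-- The denominator of `ε` serves as threshold: beyond it `p ^ n ≥ 2 ^ n > n ≥ ↧ₙ ε`, so `1 / p ^ n`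
-- is below `ε`.
theorem5p6 p p-prime ¬2∣p 𝔽 ν ε 0<ε = ℚ.↧ₙ ε , bound
  where
  μ = v₂ (p ∸ 1) ⊔ v₂ (p + 1)
  p^n≢0 : ∀ n → NonZero (p ^ n)
  p^n≢0 n = m^n≢0 p n {{prime⇒nonZero p-prime}}
  2≤p : 2 ≤ p
  2≤p = ℕ.nonTrivial⇒n>1 p {{prime⇒nonTrivial p-prime}}
  j : ℕ
  j = proj₁ (nearSign-prime p-prime ¬2∣p)
  M≡ : μ + ν ≡ 2 + (j + ν)
  M≡ = cong (_+ ν) (proj₁ (proj₂ (nearSign-prime p-prime ¬2∣p)))
  bound : ∀ n → .{{_ : NonZero n}} → ℚ.↧ₙ ε ≤ n → v₂ n ≡ ν →
    ℚ.∣ _/_ (+ (#Per (T 2) (𝔽 n))) (p ^ n) {{p^n≢0 n}}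
      ℚ.- _/_ (+ (2 ^ (μ + ν ∸ 1) + 1)) (2 ^ (μ + ν + 1)) {{m^n≢0 2 (μ + ν + 1)}} ∣ ℚ.< ε
  bound n d≤n v₂n≡ν =
    let near-q = subst (λ ν → NearSign (2 + (j + ν)) (+ (p ^ n))) v₂n≡ν
          (nearSign-power n j (proj₂ (proj₂ (nearSign-prime p-prime ¬2∣p))))
        N , s , m , N±1 , 4∣N , N≡ , odd-m , count = #Per-T₂ (𝔽 n) (nearSign⇒odd (j + ν) near-q)
        s≡ = odd-part-exponent (j + ν) s near-q N±1 4∣N N≡ odd-m
    in density-estimate (μ + ν) (j + ν) {#Per (T 2) (𝔽 n)} {{p^n≢0 n}} {{m^n≢0 2 (μ + ν + 1)}} M≡ N±1
         (trans N≡ (cong (λ e → 2 ^ e * m) (trans s≡ (sym M≡)))) count ε 0<ε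
         (ℕ.≤-trans d≤n (ℕ.≤-trans (ℕ.<⇒≤ (n<2^n n)) (ℕ.^-monoˡ-≤ n 2≤p)))
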